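{- Let $m\ge 1$, let $0<b_0<b_1<\cdots<b_m$ be integers and let $e_0,e_1,\dots,e_m$ be positive integers. Assume there exist a prime $p$ and a positive integer $t$ such that $p^t\mid b_0$ but $p^t\nmid b_i$ for all $1\le i\le m$. Put $\mathrm M=\{(b_0,e_0),\dots,(b_m,e_m)\}$. Then for every infinite set $\mathcal A$ of positive integers, the representation function $r_{\mathrm M}(n,\mathcal A)$ is not constant for $n$ large enough; that is, there are no constant $c$ and no integer $n_0$ such that $r_{\mathrm M}(n,\mathcal A)=c$ for all $n>n_0$.
   Context: For $\mathrm M=\{(b_0,e_0),\dots,(b_m,e_m)\}$ and a set $\mathcal A$ of integers $\ge 0$, $r_{\mathrm M}(n,\mathcal A)$ denotes the number of tuples $(a_{i,j})_{0\le i\le m,\ 1\le j\le e_i}$ with all $a_{i,j}\in\mathcal A$ and $$n=b_0(a_{0,1}+\cdots+a_{0,e_0})+b_1(a_{1,1}+\cdots+a_{1,e_1})+\cdots+b_m(a_{m,1}+\cdots+a_{m,e_m}).$$ -}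

module Defs where

open import Algebra.Properties.CommutativeMonoid.Sum using (sum-syntax)
open import Data.Fin.Base using (Fin)
open import Data.List.Base using (List)
open import Data.List.Membership.Propositional using (_∈_)
open import Data.Nat.Base using (ℕ; _*_)
open import Data.Nat.Properties using (+-0-commutativeMonoid)
open import Data.Product.Base using (Σ-syntax; ∃-syntax; _×_; _,_; proj₁)
open import Data.Vec.Functional using (Vector)
open import Function.Bundles using (Inverse)
open import Level using (Level; 0ℓ)
open import Relation.Binary.Bundles using (Setoid)
open import Relation.Binary.PropositionalEquality using (_≡_; refl; sym; trans; setoid)
open import Relation.Nullary.Negation using (¬_)
open import Relation.Unary using (Pred)

private
  variable
    ℓ : Level
    k : ℕ

Finite : Pred ℕ ℓ → Set ℓ
Finite A = ∃[ xs ] (∀ a → A a → a ∈ xs)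

Infinite : Pred ℕ ℓ → Set ℓ
Infinite A = ¬ Finite A

∑ : ∀ n → Vector ℕ n → ℕ
∑ = sum-syntax +-0-commutativeMonoid

-- M = {(b₀,e₀),…,(bₘ,eₘ)} is given by its two coordinate vectors b and e,
-- of length k = suc m.  The inner index j runs over 0,…,eᵢ-1.

Tuple : Vector ℕ k → Set
Tuple {k} e = (i : Fin k) → Fin (e i) → ℕ

linearForm : (b e : Vector ℕ k) → Tuple e → ℕ
linearForm {k} b e a = ∑ k (λ i → b i * ∑ (e i) (λ j → a i j))

IsRepresentation : (b e : Vector ℕ k) → ℕ → Pred ℕ ℓ → Tuple e → Set ℓ
IsRepresentation b e n A a = (∀ i j → A (a i j)) × n ≡ linearForm b e a

-- Two representations are the same when their entries agree; the proofs of
-- membership in A are not counted.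

Representations : (b e : Vector ℕ k) → ℕ → Pred ℕ ℓ → Setoid ℓ 0ℓ
Representations b e n A = record
  { Carrier       = Σ[ a ∈ Tuple e ] IsRepresentation b e n A a
  ; _≈_           = λ r s → ∀ i j → proj₁ r i j ≡ proj₁ s i j
  ; isEquivalence = record
    { refl  = λ i j → refl
    ; sym   = λ p i j → sym (p i j)
    ; trans = λ p q i j → trans (p i j) (q i j)
    }
  }

-- r_M(n,A) = c.  This is a relation rather than a function into ℕ because A is
-- not assumed decidable; c is unique when it exists.

r[_,_]⟨_,_⟩≡_ : (b e : Vector ℕ k) → ℕ → Pred ℕ ℓ → ℕ → Set ℓ
r[ b , e ]⟨ n , A ⟩≡ c = Inverse (setoid (Fin c)) (Representations b e n A)

{-# OPTIONS --safe #-}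
module Submission where

-- Write f for the generating series of A, shifted so that f(0) = 1, and l for the coefficients of its
-- logarithmic derivative z f′/f.  If r is eventually constant then ∏ f(z^bᵢ)^eᵢ is a polynomial over
-- 1 - z, hence D(n) = Σ eᵢ bᵢ l(n/bᵢ) is, modulo every M prime to some fixed number, periodic in n with
-- a period that is polynomial in M.  Solving for l(n) in the equation at b₀ n involves only l(b₀ n/bᵢ)
-- with b₀ n/bᵢ smaller than n and more divisible by p, and this makes l itself periodic modulo M, again
-- with period W polynomial in M.  Consequently M divides n whenever n in (the shifted) A follows a gap of
-- length W.  Choosing many pairwise coprime M shows that A has no long gaps below the product of the
-- moduli, so A is too dense there for r to be bounded.

open import Defs
open import Data.Empty using (⊥)
open import Data.Fin.Base using (Fin; zero; suc; toℕ; fromℕ<; splitAt; remQuot; combine; inject≤; funToFin; finToFun; _↑ˡ_; _↑ʳ_) renaming (_<_ to _<ᶠ_)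
import Data.Fin.Properties as Fin
open import Data.Integer.Base as ℤ using (ℤ; +_; 0ℤ; 1ℤ)
import Data.Integer.Divisibility.Signed as ℤ∣
open import Data.Integer.DivMod using (_%ℕ_; _/ℕ_; n%ℕd<d; a≡a%ℕn+[a/ℕn]*n)
import Data.Integer.Properties as ℤ
open import Data.Integer.Tactic.RingSolver using (solve-∀)
open import Data.List.Base using (upTo)
open import Data.List.Membership.Propositional.Properties using (∈-upTo⁺)
open import Data.Nat.Base using (ℕ; zero; suc; pred; _+_; _*_; _∸_; _^_; _!; _⊔_; _≤_; _<_; z≤n; s≤s; s<s; z<s; s≤s⁻¹; NonZero; >-nonZero; >-nonZero⁻¹; nonTrivial⇒n>1)
open import Data.Nat.Coprimality as Coprime using (Coprime; coprime-divisor; coprime-Bézout)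
open import Data.Nat.Divisibility
open import Data.Nat.DivMod using (_/_; _%_; m≡m%n+[m/n]*n; m%n<n; m/n*n≤m)
open import Data.Nat.GCD using (module Bézout)
open import Data.Nat.Induction using (<-rec)
open import Data.Nat.Primality using (Prime; prime⇒irreducible; euclidsLemma; prime⇒nonZero; prime⇒nonTrivial)
import Data.Nat.Properties as ℕ
import Data.Nat.Tactic.RingSolver as ℕSolver
open import Data.Product.Base using (Σ-syntax; ∃-syntax; _×_; _,_; proj₁; proj₂; uncurry)
open import Data.Sum.Base using (_⊎_; inj₁; inj₂; [_,_]′)
open import Data.Vec.Functional using (Vector)
open import Function.Base using (_∘_)
open import Function.Bundles using (Inverse)
open import Level using (Level)
open import Relation.Binary.Definitions using (tri<; tri≈; tri>)
open import Relation.Binary.PropositionalEquality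
open import Relation.Nullary using (Dec; yes; no; contradiction)
open import Relation.Nullary.Negation using (¬_)
open import Relation.Unary using (Pred; Decidable)
open import Algebra.Properties.CommutativeMonoid.Sum ℤ.+-0-commutativeMonoid using (sum; sum-cong-≗)

-- The descent at `b₀ n` carries periodicity from multiples of `p ^ suc k` to multiples of `p ^ k`,
-- so it needs some `k` to start from, and for `l` none is at hand. The start comes from dilations.
-- If `s` is prime to every `bᵢ`, then replacing `l` by n ↦ l(s n) replaces D by n ↦ D(s n). The
-- prime `p` itself need not qualify, but some `s` congruent to `p` modulo a suitable `W` does, and
-- then l(p n) ≡ l(s n) whenever `n` is divisible enough by `p`. Powers of `p` can thus be traded
-- for numbers prime to `p`, among which congruent arguments are compared by further dilations. Each
-- descent step multiplies the period by a fixed B. The number of steps is governed by the exponent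
-- of `p` in the period of D, which is logarithmic in that period, so the total loss stays
-- polynomial. Polynomial size is what the end of the proof needs: with moduli of order y, gaps are
-- O(y^C), so counting pairs bounds the elements of A below the product by O(y^(2C)), while the
-- product of 2C + 1 moduli is at least y^(2C + 1).

private
  variable
    ℓ : Level

-- Formal power series

Series : Set
Series = ℕ → ℤ

infixl 7 _⊛_
infixl 6 _⊕_

_⊛_ : Series → Series → Series
(f ⊛ g) zero    = f 0 ℤ.* g 0
(f ⊛ g) (suc n) = f 0 ℤ.* g (suc n) ℤ.+ (f ∘ suc ⊛ g) n

_⊕_ : Series → Series → Series
(f ⊕ g) n = f n ℤ.+ g n

infixr 7.5 _·_
_·_ : ℤ → Series → Series
(c · f) n = c ℤ.* f n

one : Series
one zero    = 1ℤ
one (suc _) = 0ℤ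

null : Series
null _ = 0ℤ

-- ϑ is z d/dz and ∇ is multiplication by 1 - z.
ϑ : Series → Series
ϑ f n = + n ℤ.* f n

∇ : Series → Series
∇ f zero    = f 0
∇ f (suc n) = f (suc n) ℤ.- f n

⊛-cong-≤ : ∀ {f f′ g g′} n → (∀ k → k ≤ n → f k ≡ f′ k) → (∀ k → k ≤ n → g k ≡ g′ k) →
           (f ⊛ g) n ≡ (f′ ⊛ g′) n
⊛-cong-≤ zero p q = cong₂ ℤ._*_ (p 0 z≤n) (q 0 z≤n)
⊛-cong-≤ (suc n) p q =
  cong₂ ℤ._+_ (cong₂ ℤ._*_ (p 0 z≤n) (q (suc n) ℕ.≤-refl))
    (⊛-cong-≤ n (λ k k≤n → p (suc k) (s≤s k≤n)) (λ k k≤n → q k (ℕ.m≤n⇒m≤1+n k≤n)))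

⊛-cong : ∀ {f f′ g g′} → f ≗ f′ → g ≗ g′ → f ⊛ g ≗ f′ ⊛ g′
⊛-cong p q n = ⊛-cong-≤ n (λ k _ → p k) (λ k _ → q k)

⊛-zeroˡ : ∀ {f} g → (∀ n → f n ≡ 0ℤ) → ∀ n → (f ⊛ g) n ≡ 0ℤ
⊛-zeroˡ g p zero rewrite p 0 = ℤ.*-zeroˡ (g 0)
⊛-zeroˡ g p (suc n) rewrite p 0 | ℤ.*-zeroˡ (g (suc n)) | ⊛-zeroˡ g (p ∘ suc) n = refl

⊛-zeroʳ : ∀ f n → (f ⊛ null) n ≡ 0ℤ
⊛-zeroʳ f zero = ℤ.*-zeroʳ (f 0)
⊛-zeroʳ f (suc n) rewrite ℤ.*-zeroʳ (f 0) | ⊛-zeroʳ (f ∘ suc) n = refl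

⊛-identityˡ : ∀ g → one ⊛ g ≗ g
⊛-identityˡ g zero = ℤ.*-identityˡ (g 0)
⊛-identityˡ g (suc n) rewrite ⊛-zeroˡ {one ∘ suc} g (λ _ → refl) n =
  trans (ℤ.+-identityʳ _) (ℤ.*-identityˡ _)

⊛-distribʳ : ∀ h f g → (f ⊕ g) ⊛ h ≗ f ⊛ h ⊕ g ⊛ h
⊛-distribʳ h f g zero = ℤ.*-distribʳ-+ (h 0) (f 0) (g 0)
⊛-distribʳ h f g (suc n) rewrite ⊛-distribʳ h (f ∘ suc) (g ∘ suc) n =
  lem (f 0) (g 0) (h (suc n)) _ _
  where
  lem : ∀ a b c x y → (a ℤ.+ b) ℤ.* c ℤ.+ (x ℤ.+ y) ≡ a ℤ.* c ℤ.+ x ℤ.+ (b ℤ.* c ℤ.+ y)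
  lem = solve-∀

⊛-distribˡ : ∀ f g h → f ⊛ (g ⊕ h) ≗ f ⊛ g ⊕ f ⊛ h
⊛-distribˡ f g h zero = ℤ.*-distribˡ-+ (f 0) (g 0) (h 0)
⊛-distribˡ f g h (suc n) rewrite ⊛-distribˡ (f ∘ suc) g h n =
  lem (f 0) (g (suc n)) (h (suc n)) _ _
  where
  lem : ∀ a b c x y → a ℤ.* (b ℤ.+ c) ℤ.+ (x ℤ.+ y) ≡ a ℤ.* b ℤ.+ x ℤ.+ (a ℤ.* c ℤ.+ y)
  lem = solve-∀

·-⊛ : ∀ c f g → (c · f) ⊛ g ≗ c · (f ⊛ g)
·-⊛ c f g zero = ℤ.*-assoc c (f 0) (g 0)
·-⊛ c f g (suc n) rewrite ·-⊛ c (f ∘ suc) g n = lem c (f 0) (g (suc n)) _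
  where
  lem : ∀ c a b x → c ℤ.* a ℤ.* b ℤ.+ c ℤ.* x ≡ c ℤ.* (a ℤ.* b ℤ.+ x)
  lem = solve-∀

-- The product recurses on its left factor; this mirror image of its recursion is what commutativity
-- rests on.
⊛-sucʳ : ∀ f g n → (f ⊛ g) (suc n) ≡ f (suc n) ℤ.* g 0 ℤ.+ (f ⊛ g ∘ suc) n
⊛-sucʳ f g zero = ℤ.+-comm (f 0 ℤ.* g 1) (f 1 ℤ.* g 0)
⊛-sucʳ f g (suc n) rewrite ⊛-sucʳ (f ∘ suc) g n =
  lem (f 0 ℤ.* g (suc (suc n))) (f (suc (suc n)) ℤ.* g 0) ((f ∘ suc ⊛ g ∘ suc) n)
  where
  lem : ∀ a b c → a ℤ.+ (b ℤ.+ c) ≡ b ℤ.+ (a ℤ.+ c)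
  lem = solve-∀

⊛-comm : ∀ f g → f ⊛ g ≗ g ⊛ f
⊛-comm f g zero = ℤ.*-comm (f 0) (g 0)
⊛-comm f g (suc n) rewrite ⊛-sucʳ g f n | ⊛-comm (f ∘ suc) g n =
  cong (ℤ._+ (g ⊛ f ∘ suc) n) (ℤ.*-comm (f 0) (g (suc n)))

⊛-assoc : ∀ f g h → f ⊛ g ⊛ h ≗ f ⊛ (g ⊛ h)
⊛-assoc f g h zero = ℤ.*-assoc (f 0) (g 0) (h 0)
⊛-assoc f g h (suc n) = begin
  f 0 ℤ.* g 0 ℤ.* h (suc n) ℤ.+ ((f 0 · (g ∘ suc) ⊕ f ∘ suc ⊛ g) ⊛ h) n
    ≡⟨ cong (ℤ._+_ (f 0 ℤ.* g 0 ℤ.* h (suc n))) (⊛-distribʳ h (f 0 · (g ∘ suc)) (f ∘ suc ⊛ g) n) ⟩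
  f 0 ℤ.* g 0 ℤ.* h (suc n) ℤ.+ (((f 0 · (g ∘ suc)) ⊛ h) n ℤ.+ (f ∘ suc ⊛ g ⊛ h) n)
    ≡⟨ cong₂ (λ x y → f 0 ℤ.* g 0 ℤ.* h (suc n) ℤ.+ (x ℤ.+ y))
         (·-⊛ (f 0) (g ∘ suc) h n) (⊛-assoc (f ∘ suc) g h n) ⟩
  f 0 ℤ.* g 0 ℤ.* h (suc n) ℤ.+ (f 0 ℤ.* (g ∘ suc ⊛ h) n ℤ.+ (f ∘ suc ⊛ (g ⊛ h)) n)
    ≡⟨ lem (f 0) (g 0) (h (suc n)) _ _ ⟩
  f 0 ℤ.* (g 0 ℤ.* h (suc n) ℤ.+ (g ∘ suc ⊛ h) n) ℤ.+ (f ∘ suc ⊛ (g ⊛ h)) n ∎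
  where
  open ≡-Reasoning
  lem : ∀ a b c x y → a ℤ.* b ℤ.* c ℤ.+ (a ℤ.* x ℤ.+ y) ≡ a ℤ.* (b ℤ.* c ℤ.+ x) ℤ.+ y
  lem = solve-∀

ϑ-⊛ : ∀ f g → ϑ (f ⊛ g) ≗ ϑ f ⊛ g ⊕ f ⊛ ϑ g
ϑ-⊛ f g zero = lem (f 0) (g 0)
  where
  lem : ∀ a b → 0ℤ ℤ.* (a ℤ.* b) ≡ 0ℤ ℤ.* a ℤ.* b ℤ.+ a ℤ.* (0ℤ ℤ.* b)
  lem = solve-∀
ϑ-⊛ f g (suc n) = begin
  + suc n ℤ.* (f 0 ℤ.* g (suc n) ℤ.+ t)
    ≡⟨ lem₁ (+ n) (f 0) (g (suc n)) t ⟩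
  (1ℤ ℤ.+ + n) ℤ.* (f 0 ℤ.* g (suc n)) ℤ.+ (+ n ℤ.* t ℤ.+ t)
    ≡⟨ cong (λ x → (1ℤ ℤ.+ + n) ℤ.* (f 0 ℤ.* g (suc n)) ℤ.+ (x ℤ.+ t)) (ϑ-⊛ (f ∘ suc) g n) ⟩
  (1ℤ ℤ.+ + n) ℤ.* (f 0 ℤ.* g (suc n)) ℤ.+ (u ℤ.+ v ℤ.+ t)
    ≡⟨ lem₂ (+ n) (f 0) (g (suc n)) t u v ⟩
  0ℤ ℤ.* f 0 ℤ.* g (suc n) ℤ.+ (u ℤ.+ t) ℤ.+ (f 0 ℤ.* ((1ℤ ℤ.+ + n) ℤ.* g (suc n)) ℤ.+ v)
    ≡⟨ cong (λ x → 0ℤ ℤ.* f 0 ℤ.* g (suc n) ℤ.+ x ℤ.+ (f 0 ℤ.* (+ suc n ℤ.* g (suc n)) ℤ.+ v))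
         (trans (sym (⊛-distribʳ g (ϑ (f ∘ suc)) (f ∘ suc) n))
                (⊛-cong (λ k → lem₃ (+ k) (f (suc k))) (λ _ → refl) n)) ⟩
  0ℤ ℤ.* f 0 ℤ.* g (suc n) ℤ.+ ((ϑ f ∘ suc) ⊛ g) n ℤ.+ (f 0 ℤ.* (+ suc n ℤ.* g (suc n)) ℤ.+ v) ∎
  where
  open ≡-Reasoning
  t = (f ∘ suc ⊛ g) n
  u = (ϑ (f ∘ suc) ⊛ g) n
  v = (f ∘ suc ⊛ ϑ g) n
  lem₁ : ∀ n a b t → (1ℤ ℤ.+ n) ℤ.* (a ℤ.* b ℤ.+ t) ≡ (1ℤ ℤ.+ n) ℤ.* (a ℤ.* b) ℤ.+ (n ℤ.* t ℤ.+ t)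
  lem₁ = solve-∀
  lem₂ : ∀ n a b t u v → (1ℤ ℤ.+ n) ℤ.* (a ℤ.* b) ℤ.+ (u ℤ.+ v ℤ.+ t) ≡
         0ℤ ℤ.* a ℤ.* b ℤ.+ (u ℤ.+ t) ℤ.+ (a ℤ.* ((1ℤ ℤ.+ n) ℤ.* b) ℤ.+ v)
  lem₂ = solve-∀
  lem₃ : ∀ k x → k ℤ.* x ℤ.+ x ≡ (1ℤ ℤ.+ k) ℤ.* x
  lem₃ = solve-∀

∇-⊛ : ∀ f g → ∇ (f ⊛ g) ≗ ∇ f ⊛ g
∇-⊛ f g zero = refl
∇-⊛ f g (suc n) = begin
  f 0 ℤ.* g (suc n) ℤ.+ (f ∘ suc ⊛ g) n ℤ.- (f ⊛ g) n
    ≡⟨ lem (f 0 ℤ.* g (suc n)) ((f ∘ suc ⊛ g) n) ((f ⊛ g) n) ⟩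
  f 0 ℤ.* g (suc n) ℤ.+ ((f ∘ suc ⊛ g) n ℤ.+ (ℤ.- 1ℤ) ℤ.* (f ⊛ g) n)
    ≡⟨ cong (λ x → f 0 ℤ.* g (suc n) ℤ.+ ((f ∘ suc ⊛ g) n ℤ.+ x)) (sym (·-⊛ (ℤ.- 1ℤ) f g n)) ⟩
  f 0 ℤ.* g (suc n) ℤ.+ ((f ∘ suc ⊛ g) n ℤ.+ (((ℤ.- 1ℤ) · f) ⊛ g) n)
    ≡⟨ cong (ℤ._+_ (f 0 ℤ.* g (suc n))) (sym (⊛-distribʳ g (f ∘ suc) ((ℤ.- 1ℤ) · f) n)) ⟩
  f 0 ℤ.* g (suc n) ℤ.+ ((f ∘ suc ⊕ (ℤ.- 1ℤ) · f) ⊛ g) n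
    ≡⟨ cong (ℤ._+_ (f 0 ℤ.* g (suc n))) (⊛-cong {g = g} (λ k → lem′ (f (suc k)) (f k)) (λ _ → refl) n) ⟩
  f 0 ℤ.* g (suc n) ℤ.+ (∇ f ∘ suc ⊛ g) n ∎
  where
  open ≡-Reasoning
  lem : ∀ a b c → a ℤ.+ b ℤ.- c ≡ a ℤ.+ (b ℤ.+ (ℤ.- 1ℤ) ℤ.* c)
  lem = solve-∀
  lem′ : ∀ a b → a ℤ.+ (ℤ.- 1ℤ) ℤ.* b ≡ a ℤ.- b
  lem′ = solve-∀

-- Substitution of z^b.
ψ : {X : Set} → X → ℕ → (ℕ → X) → ℕ → X
ψ ε b f n with b ∣? n
... | yes (divides q _) = f q
... | no _              = ε

ψ-* : ∀ {X : Set} (ε : X) b .{{_ : NonZero b}} f x → ψ ε b f (b * x) ≡ f x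
ψ-* ε b f x with b ∣? b * x
... | yes (divides q eq) = cong f (ℕ.*-cancelʳ-≡ q x b (trans (sym eq) (ℕ.*-comm b x)))
... | no ∤ = contradiction (m∣m*n x) ∤

ψ-∤ : ∀ {X : Set} (ε : X) b f {n} → ¬ (b ∣ n) → ψ ε b f n ≡ ε
ψ-∤ ε b f {n} ∤ with b ∣? n
... | yes d = contradiction d ∤
... | no _  = refl

ψ-cong : ∀ {X : Set} (ε : X) b {f g} → f ≗ g → ψ ε b f ≗ ψ ε b g
ψ-cong ε b p n with b ∣? n
... | yes (divides q _) = p q
... | no _              = refl

ψℤ : ℕ → Series → Series
ψℤ = ψ 0ℤ

drop : ℕ → Series → Series
drop j f k = f (j + k)

skip : ∀ j {F} G n → (∀ k → k < j → F k ≡ 0ℤ) → (F ⊛ G) (j + n) ≡ (drop j F ⊛ G) n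
skip zero G n p = refl
skip (suc j) {F} G n p rewrite p 0 z<s | ℤ.*-zeroˡ (G (suc (j + n))) =
  trans (ℤ.+-identityˡ _) (skip j G n (λ k k<j → p (suc k) (s<s k<j)))

⊛-const : ∀ {F} G n → (∀ k → k < n → F (suc k) ≡ 0ℤ) → (F ⊛ G) n ≡ F 0 ℤ.* G n
⊛-const G zero p = refl
⊛-const {F} G (suc n) p =
  trans (cong (ℤ._+_ (F 0 ℤ.* G (suc n))) zeros) (ℤ.+-identityʳ _)
  where
  zeros : (F ∘ suc ⊛ G) n ≡ 0ℤ
  zeros = trans (⊛-const {F ∘ suc} G n (λ k k<n → p (suc k) (s<s k<n)))
    (case₀ n p)
    where
    case₀ : ∀ n → (∀ k → k < suc n → F (suc k) ≡ 0ℤ) → F 1 ℤ.* G n ≡ 0ℤ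
    case₀ n p rewrite p 0 z<s = ℤ.*-zeroˡ (G n)

module _ (b : ℕ) .{{_ : NonZero b}} where

  ψ-zero : ∀ {X : Set} (ε : X) f → ψ ε b f 0 ≡ f 0
  ψ-zero ε f = trans (cong (ψ ε b f) (sym (ℕ.*-zeroʳ b))) (ψ-* ε b f 0)

  ψ-shift : ∀ {X : Set} (ε : X) f n → ψ ε b f (b + n) ≡ ψ ε b (f ∘ suc) n
  ψ-shift ε f n with b ∣? n
  ... | yes (divides q refl) =
    trans (cong (ψ ε b f) (trans (cong (λ x → b + x) (ℕ.*-comm q b)) (sym (ℕ.*-suc b q))))
          (ψ-* ε b f (suc q))
  ... | no ∤ = ψ-∤ ε b f (λ d → ∤ (∣m+n∣m⇒∣n d n∣n))

  ψ-small : ∀ f r → r < b → 0 < r → ψℤ b f r ≡ 0ℤ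
  ψ-small f (suc r) r<b _ = ψ-∤ 0ℤ b f (λ d → ℕ.<⇒≱ r<b (∣⇒≤ d))

  ψ-⊕ : ∀ c f g n → ψℤ b (c · f ⊕ g) n ≡ c ℤ.* ψℤ b f n ℤ.+ ψℤ b g n
  ψ-⊕ c f g n with b ∣? n
  ... | yes (divides q _) = refl
  ... | no _ rewrite ℤ.*-zeroʳ c = refl

  -- For a left factor supported on multiples of `b`, the recursion of `⊛` advances by `b` at once.
  ⊛-stretch : ∀ {F} G n → (∀ k → k < pred b → F (suc k) ≡ 0ℤ) →
              (F ⊛ G) (b + n) ≡ F 0 ℤ.* G (b + n) ℤ.+ (drop b F ⊛ G) n
  ⊛-stretch {F} G n p = go b p
    where
    go : ∀ b → (∀ k → k < pred b → F (suc k) ≡ 0ℤ) → .{{_ : NonZero b}} →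
         (F ⊛ G) (b + n) ≡ F 0 ℤ.* G (b + n) ℤ.+ (drop b F ⊛ G) n
    go (suc c) p = cong (ℤ._+_ (F 0 ℤ.* G (suc c + n))) (skip c G n p)

  ψ-⊛ : ∀ f g → ψℤ b (f ⊛ g) ≗ ψℤ b f ⊛ ψℤ b g
  ψ-⊛ f g n = subst (λ n → ψℤ b (f ⊛ g) n ≡ (ψℤ b f ⊛ ψℤ b g) n)
    (sym (trans (m≡m%n+[m/n]*n n b) (ℕ.+-comm (n % b) _)))
    (go f (n / b) (n % b) (m%n<n n b))
    where
    small : ∀ f k → k < pred b → ψℤ b f (suc k) ≡ 0ℤ
    small f k k< = ψ-small f (suc k) (ℕ.<-≤-trans (s<s k<) (ℕ.≤-reflexive (ℕ.suc-pred b))) z<s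
    -- Induction on the quotient by `b`, with `f` general because each step passes to `f ∘ suc`.
    go : ∀ f q r → r < b → ψℤ b (f ⊛ g) (q * b + r) ≡ (ψℤ b f ⊛ ψℤ b g) (q * b + r)
    go f zero zero r<b =
      trans (ψ-zero 0ℤ (f ⊛ g)) (cong₂ ℤ._*_ (sym (ψ-zero 0ℤ f)) (sym (ψ-zero 0ℤ g)))
    go f zero (suc r) r<b = trans (ψ-small (f ⊛ g) (suc r) r<b z<s) (sym (begin
      (ψℤ b f ⊛ ψℤ b g) (suc r)
        ≡⟨ ⊛-const {ψℤ b f} (ψℤ b g) (suc r) (λ k k<r → ψ-small f (suc k) (ℕ.≤-<-trans k<r r<b) z<s) ⟩
      ψℤ b f 0 ℤ.* ψℤ b g (suc r)
        ≡⟨ cong (ψℤ b f 0 ℤ.*_) (ψ-small g (suc r) r<b z<s) ⟩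
      ψℤ b f 0 ℤ.* 0ℤ
        ≡⟨ ℤ.*-zeroʳ (ψℤ b f 0) ⟩
      0ℤ ∎))
      where open ≡-Reasoning
    go f (suc q) r r<b rewrite ℕ.+-assoc b (q * b) r = begin
      ψℤ b (f ⊛ g) (b + n′)
        ≡⟨ ψ-shift 0ℤ (f ⊛ g) n′ ⟩
      ψℤ b (f 0 · (g ∘ suc) ⊕ f ∘ suc ⊛ g) n′
        ≡⟨ ψ-⊕ (f 0) (g ∘ suc) (f ∘ suc ⊛ g) n′ ⟩
      f 0 ℤ.* ψℤ b (g ∘ suc) n′ ℤ.+ ψℤ b (f ∘ suc ⊛ g) n′
        ≡⟨ cong₂ ℤ._+_ (cong₂ ℤ._*_ (sym (ψ-zero 0ℤ f)) (sym (ψ-shift 0ℤ g n′)))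
             (trans (go (f ∘ suc) q r r<b)
               (⊛-cong {g = ψℤ b g} (λ k → sym (ψ-shift 0ℤ f k)) (λ _ → refl) n′)) ⟩
      ψℤ b f 0 ℤ.* ψℤ b g (b + n′) ℤ.+ (drop b (ψℤ b f) ⊛ ψℤ b g) n′
        ≡⟨ sym (⊛-stretch {ψℤ b f} (ψℤ b g) n′ (small f)) ⟩
      (ψℤ b f ⊛ ψℤ b g) (b + n′) ∎
      where
      open ≡-Reasoning
      n′ = q * b + r

-- Logarithmic derivatives, with the denominator cleared

LogDerivative : Series → Series → Set
LogDerivative f l = ϑ f ≗ f ⊛ l

⊛-swap : ∀ f g h → f ⊛ g ⊛ h ≗ f ⊛ h ⊛ g
⊛-swap f g h n = begin
  (f ⊛ g ⊛ h) n   ≡⟨ ⊛-assoc f g h n ⟩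
  (f ⊛ (g ⊛ h)) n ≡⟨ ⊛-cong {f} (λ _ → refl) (⊛-comm g h) n ⟩
  (f ⊛ (h ⊛ g)) n ≡⟨ sym (⊛-assoc f h g n) ⟩
  (f ⊛ h ⊛ g) n   ∎
  where open ≡-Reasoning

logDerivative-⊛ : ∀ {f g l m} → LogDerivative f l → LogDerivative g m →
                  LogDerivative (f ⊛ g) (l ⊕ m)
logDerivative-⊛ {f} {g} {l} {m} p q n = begin
  ϑ (f ⊛ g) n
    ≡⟨ ϑ-⊛ f g n ⟩
  (ϑ f ⊛ g) n ℤ.+ (f ⊛ ϑ g) n
    ≡⟨ cong₂ ℤ._+_ (⊛-cong {g = g} p (λ _ → refl) n) (⊛-cong {f} (λ _ → refl) q n) ⟩
  (f ⊛ l ⊛ g) n ℤ.+ (f ⊛ (g ⊛ m)) n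
    ≡⟨ cong₂ ℤ._+_ (⊛-swap f l g n) (sym (⊛-assoc f g m n)) ⟩
  (f ⊛ g ⊛ l) n ℤ.+ (f ⊛ g ⊛ m) n
    ≡⟨ sym (⊛-distribˡ (f ⊛ g) l m n) ⟩
  (f ⊛ g ⊛ (l ⊕ m)) n ∎
  where open ≡-Reasoning

logDerivative-one : LogDerivative one null
logDerivative-one zero    = refl
logDerivative-one (suc n) = trans (ℤ.*-zeroʳ (+ suc n)) (sym (⊛-zeroʳ one (suc n)))

⊛-· : ∀ c f g → f ⊛ c · g ≗ c · (f ⊛ g)
⊛-· c f g n = begin
  (f ⊛ c · g) n       ≡⟨ ⊛-comm f (c · g) n ⟩
  ((c · g) ⊛ f) n     ≡⟨ ·-⊛ c g f n ⟩
  c ℤ.* (g ⊛ f) n     ≡⟨ cong (c ℤ.*_) (⊛-comm g f n) ⟩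
  c ℤ.* (f ⊛ g) n     ∎
  where open ≡-Reasoning

logDerivative-ψ : ∀ b .{{_ : NonZero b}} {f l} → LogDerivative f l →
                  LogDerivative (ψℤ b f) (+ b · ψℤ b l)
logDerivative-ψ b {f} {l} p n = begin
  ϑ (ψℤ b f) n                  ≡⟨ lem ⟩
  + b ℤ.* ψℤ b (ϑ f) n          ≡⟨ cong (+ b ℤ.*_) (ψ-cong 0ℤ b p n) ⟩
  + b ℤ.* ψℤ b (f ⊛ l) n        ≡⟨ cong (+ b ℤ.*_) (ψ-⊛ b f l n) ⟩
  + b ℤ.* (ψℤ b f ⊛ ψℤ b l) n   ≡⟨ sym (⊛-· (+ b) (ψℤ b f) (ψℤ b l) n) ⟩
  (ψℤ b f ⊛ + b · ψℤ b l) n     ∎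
  where
  open ≡-Reasoning
  lem : ϑ (ψℤ b f) n ≡ + b ℤ.* ψℤ b (ϑ f) n
  lem with b ∣? n
  ... | no _ = trans (ℤ.*-zeroʳ (+ n)) (sym (ℤ.*-zeroʳ (+ b)))
  ... | yes (divides q refl) = begin
    + (q * b) ℤ.* f q       ≡⟨ cong (λ x → + x ℤ.* f q) (ℕ.*-comm q b) ⟩
    + (b * q) ℤ.* f q       ≡⟨ cong (ℤ._* f q) (ℤ.pos-* b q) ⟩
    + b ℤ.* + q ℤ.* f q     ≡⟨ ℤ.*-assoc (+ b) (+ q) (f q) ⟩
    + b ℤ.* (+ q ℤ.* f q)   ∎

power : Series → ℕ → Series
power f zero    = one
power f (suc e) = f ⊛ power f e

logDerivative-power : ∀ {f l} e → LogDerivative f l → LogDerivative (power f e) (+ e · l)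
logDerivative-power {f} {l} zero p n =
  trans (logDerivative-one n) (⊛-cong {one} (λ _ → refl) (λ k → sym (ℤ.*-zeroˡ (l k))) n)
logDerivative-power {f} {l} (suc e) p n =
  trans (logDerivative-⊛ p (logDerivative-power e p) n)
        (⊛-cong {f ⊛ power f e} (λ _ → refl) (λ k → lem (+ e) (l k)) n)
  where
  lem : ∀ e x → x ℤ.+ e ℤ.* x ≡ (1ℤ ℤ.+ e) ℤ.* x
  lem = solve-∀

∏ : ∀ {k} → Vector Series k → Series
∏ {zero}  f = one
∏ {suc k} f = f zero ⊛ ∏ (f ∘ suc)

logDerivative-∏ : ∀ {k} {f l : Vector Series k} → (∀ i → LogDerivative (f i) (l i)) →
                  LogDerivative (∏ f) (λ n → sum (λ i → l i n))
logDerivative-∏ {zero}  p = logDerivative-one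
logDerivative-∏ {suc k} p = logDerivative-⊛ (p zero) (logDerivative-∏ (p ∘ suc))

module LogDerivativeExists (f : Series) where

  step : Series → Series
  step g zero    = 0ℤ
  step g (suc n) = ϑ f (suc n) ℤ.- (f ∘ suc ⊛ g) n

  -- Solving `f ⊛ l = ϑ f` for `l n` uses all earlier coefficients, which is not a structural
  -- recursion. As `step g` at `n` reads `g` only below `n`, iterating it `k` times settles the
  -- first `k` coefficients.
  approx : ℕ → Series
  approx zero    = null
  approx (suc k) = step (approx k)

  approx-stable : ∀ k k′ n → n < k → n < k′ → approx k n ≡ approx k′ n
  approx-stable (suc k) (suc k′) zero    _ _ = refl
  approx-stable (suc k) (suc k′) (suc n) (s≤s n<k) (s≤s n<k′) =
    cong (λ x → ϑ f (suc n) ℤ.- x)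
      (⊛-cong-≤ {f ∘ suc} n (λ _ _ → refl)
        (λ j j≤n → approx-stable k k′ j (ℕ.≤-<-trans j≤n n<k) (ℕ.≤-<-trans j≤n n<k′)))

  logDerivative : Series
  logDerivative n = approx (suc n) n

  isLogDerivative : f 0 ≡ 1ℤ → LogDerivative f logDerivative
  isLogDerivative f₀ zero    rewrite f₀ = refl
  isLogDerivative f₀ (suc n) rewrite f₀ = sym (begin
    1ℤ ℤ.* (ϑ f (suc n) ℤ.- (f ∘ suc ⊛ approx (suc n)) n) ℤ.+ t
      ≡⟨ cong (λ x → 1ℤ ℤ.* (ϑ f (suc n) ℤ.- x) ℤ.+ t)
           (⊛-cong-≤ {f ∘ suc} n (λ _ _ → refl)
             (λ j j≤n → approx-stable (suc n) (suc j) j (s≤s j≤n) ℕ.≤-refl)) ⟩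
    1ℤ ℤ.* (ϑ f (suc n) ℤ.- t) ℤ.+ t
      ≡⟨ lem (ϑ f (suc n)) t ⟩
    ϑ f (suc n) ∎)
    where
    open ≡-Reasoning
    t = (f ∘ suc ⊛ logDerivative) n
    lem : ∀ a b → 1ℤ ℤ.* (a ℤ.- b) ℤ.+ b ≡ a
    lem = solve-∀

-- Congruences

x≡x-y+y : ∀ x y → x ≡ x ℤ.- y ℤ.+ y
x≡x-y+y = solve-∀

module Congruence (M : ℕ) where

  infix 4 _≈_
  record _≈_ (x y : ℤ) : Set where
    constructor mod
    field M∣x-y : + M ℤ∣.∣ x ℤ.- y
  open _≈_ public

  ≈-reflexive : ∀ {x y} → x ≡ y → x ≈ y
  ≈-reflexive {x} refl = mod (subst (+ M ℤ∣.∣_) (sym (ℤ.+-inverseʳ x)) (ℤ∣.∣ᵤ⇒∣ (M ∣0)))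

  ≈-refl : ∀ {x} → x ≈ x
  ≈-refl = ≈-reflexive refl

  ≈-sym : ∀ {x y} → x ≈ y → y ≈ x
  ≈-sym {x} {y} (mod d) = mod (subst (+ M ℤ∣.∣_) (lem x y) (ℤ∣.∣m⇒∣-m d))
    where
    lem : ∀ x y → ℤ.- (x ℤ.- y) ≡ y ℤ.- x
    lem = solve-∀

  ≈-trans : ∀ {x y z} → x ≈ y → y ≈ z → x ≈ z
  ≈-trans {x} {y} {z} (mod d) (mod e) = mod (subst (+ M ℤ∣.∣_) (lem x y z) (ℤ∣.∣m∣n⇒∣m+n d e))
    where
    lem : ∀ x y z → x ℤ.- y ℤ.+ (y ℤ.- z) ≡ x ℤ.- z
    lem = solve-∀

  +-cong : ∀ {x y u v} → x ≈ y → u ≈ v → x ℤ.+ u ≈ y ℤ.+ v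
  +-cong {x} {y} {u} {v} (mod d) (mod e) = mod (subst (+ M ℤ∣.∣_) (lem x y u v) (ℤ∣.∣m∣n⇒∣m+n d e))
    where
    lem : ∀ x y u v → x ℤ.- y ℤ.+ (u ℤ.- v) ≡ x ℤ.+ u ℤ.- (y ℤ.+ v)
    lem = solve-∀

  -‿cong : ∀ {x y u v} → x ≈ y → u ≈ v → x ℤ.- u ≈ y ℤ.- v
  -‿cong {x} {y} {u} {v} (mod d) (mod e) = mod (subst (+ M ℤ∣.∣_) (lem x y u v) (ℤ∣.∣m∣n⇒∣m-n d e))
    where
    lem : ∀ x y u v → x ℤ.- y ℤ.- (u ℤ.- v) ≡ x ℤ.- u ℤ.- (y ℤ.- v)
    lem = solve-∀

  *-congˡ : ∀ c {x y} → x ≈ y → c ℤ.* x ≈ c ℤ.* y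
  *-congˡ c {x} {y} (mod d) = mod (subst (+ M ℤ∣.∣_) (lem c x y) (ℤ∣.∣n⇒∣m*n c d))
    where
    lem : ∀ c x y → c ℤ.* (x ℤ.- y) ≡ c ℤ.* x ℤ.- c ℤ.* y
    lem = solve-∀

  *-cancelˡ : ∀ c {x y} → Coprime M ℤ.∣ c ∣ → c ℤ.* x ≈ c ℤ.* y → x ≈ y
  *-cancelˡ c {x} {y} M⊥c (mod d) = mod (ℤ∣.∣ᵤ⇒∣ (coprime-divisor M⊥c
    (subst (M ∣_) (trans (cong ℤ.∣_∣ (lem c x y)) (ℤ.abs-* c (x ℤ.- y))) (ℤ∣.∣⇒∣ᵤ d))))
    where
    lem : ∀ c x y → c ℤ.* x ℤ.- c ℤ.* y ≡ c ℤ.* (x ℤ.- y)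
    lem = solve-∀

  sum-≈ : ∀ {k} {f g : Vector ℤ k} → (∀ i → f i ≈ g i) → sum f ≈ sum g
  sum-≈ {zero}  p = ≈-refl
  sum-≈ {suc k} p = +-cong (p zero) (sum-≈ (p ∘ suc))

  sum-≈0 : ∀ {k} {f : Vector ℤ k} → (∀ i → f i ≈ 0ℤ) → sum f ≈ 0ℤ
  sum-≈0 {zero}  p = ≈-refl
  sum-≈0 {suc k} p = +-cong (p zero) (sum-≈0 (p ∘ suc))

  +-cancelʳ : ∀ {x y u v} → x ℤ.+ u ≈ y ℤ.+ v → u ≈ v → x ≈ y
  +-cancelʳ {x} {y} {u} {v} p q =
    ≈-trans (≈-reflexive (lem x u)) (≈-trans (-‿cong p q) (≈-reflexive (sym (lem y v))))
    where
    lem : ∀ x u → x ≡ x ℤ.+ u ℤ.- u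
    lem = solve-∀

  shift-multiple : ∀ {f : Series} {P : ℕ → Set} S →
    (∀ n → P n → P (n + S)) → (∀ n → P n → f (n + S) ≈ f n) →
    ∀ c n → P n → f (n + S * c) ≈ f n
  shift-multiple {f} S step h zero n Pn =
    ≈-reflexive (cong f (trans (cong (λ x → n + x) (ℕ.*-zeroʳ S)) (ℕ.+-identityʳ n)))
  shift-multiple {f} S step h (suc c) n Pn =
    ≈-trans (≈-reflexive (cong f (trans (cong (λ x → n + x) (ℕ.*-suc S c)) (sym (ℕ.+-assoc n S (S * c))))))
      (≈-trans (shift-multiple S step h c (n + S) (step n Pn)) (h n Pn))

-- Divisibility

^-distribʳ-* : ∀ k m n → (m * n) ^ k ≡ m ^ k * n ^ k
^-distribʳ-* zero    m n = refl
^-distribʳ-* (suc k) m n = trans (cong (m * n *_) (^-distribʳ-* k m n)) (lem m n (m ^ k) (n ^ k))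
  where
  lem : ∀ x y u v → x * y * (u * v) ≡ x * u * (y * v)
  lem = ℕSolver.solve-∀

coprime-∣ : ∀ {m n d} → d ∣ n → Coprime m n → Coprime m d
coprime-∣ d∣n c (e∣m , e∣d) = c (e∣m , ∣-trans e∣d d∣n)

coprime-* : ∀ {m n o} → Coprime m n → Coprime m o → Coprime m (n * o)
coprime-* c c′ (e∣m , e∣no) =
  c′ (e∣m , coprime-divisor (λ (f∣e , f∣n) → c (∣-trans f∣e e∣m , f∣n)) e∣no)

coprime-^ : ∀ {m n} k → Coprime m n → Coprime m (n ^ k)
coprime-^ zero    c (_ , e∣1) = ∣1⇒≡1 e∣1
coprime-^ (suc k) c = coprime-* c (coprime-^ k c)

module _ {p : ℕ} (pr : Prime p) where

  prime∤⇒coprime : ∀ {n} → ¬ (p ∣ n) → Coprime n p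
  prime∤⇒coprime p∤n (d∣n , d∣p) with prime⇒irreducible pr d∣p
  ... | inj₁ d≡1  = d≡1
  ... | inj₂ refl = contradiction d∣n p∤n

  p^k∣-cancelˡ : ∀ {b} k {x} → ¬ (p ∣ b) → p ^ k ∣ b * x → p ^ k ∣ x
  p^k∣-cancelˡ k p∤b = coprime-divisor (Coprime.sym (coprime-^ k (prime∤⇒coprime p∤b)))

  -- The exponent of `p` in `b` is at most `t` minus one, so at least `j + 1` of the `j + t` factors
  -- fall to `x`.
  raise : ∀ t j {b x} → ¬ (p ^ t ∣ b) → p ^ (j + t) ∣ b * x → p ^ suc j ∣ x
  raise zero j ∤ _ = contradiction (1∣ _) ∤
  raise (suc t) j {b} {x} ∤ d with p ∣? b
  ... | no p∤b = p^k∣-cancelˡ (suc j) p∤b (∣-trans (∣-p^ (s≤s (ℕ.m≤m+n j t))) (subst (λ i → p ^ i ∣ b * x) (ℕ.+-suc j t) d))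
    where
    ∣-p^ : ∀ {i k} → i ≤ k → p ^ i ∣ p ^ k
    ∣-p^ {k = k} z≤n = 1∣ (p ^ k)
    ∣-p^ (s≤s i≤k) = *-monoʳ-∣ p (∣-p^ i≤k)
  ... | yes (divides q refl) = raise t j
    (λ d′ → ∤ (subst (p ^ suc t ∣_) (ℕ.*-comm p q) (*-monoʳ-∣ p d′)))
    (*-cancelˡ-∣ p {{prime⇒nonZero pr}} (subst₂ _∣_ (cong (p ^_) (ℕ.+-suc j t)) (lem q p x) d))
    where
    lem : ∀ q p x → q * p * x ≡ p * (q * x)
    lem = ℕSolver.solve-∀

  p-part : ∀ n → 0 < n → ∃[ a ] ∃[ u ] (n ≡ p ^ a * u × ¬ (p ∣ u))
  p-part = <-rec _ go
    where
    go : ∀ n → (∀ {m} → m < n → 0 < m → ∃[ a ] ∃[ u ] (m ≡ p ^ a * u × ¬ (p ∣ u))) →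
         0 < n → ∃[ a ] ∃[ u ] (n ≡ p ^ a * u × ¬ (p ∣ u))
    go n rec 0<n with p ∣? n
    ... | no p∤n = 0 , n , sym (ℕ.*-identityˡ n) , p∤n
    go n rec () | yes (divides zero refl)
    go n rec 0<n | yes (divides (suc q) refl)
      with rec {suc q} (ℕ.m<m*n (suc q) p (nonTrivial⇒n>1 p {{prime⇒nonTrivial pr}})) z<s
    ... | a , u , eq , p∤u = suc a , u , trans (ℕ.*-comm (suc q) p) (trans (cong (p *_) eq) (sym (ℕ.*-assoc p (p ^ a) u))) , p∤u

∤⇒positive : ∀ {p n} → ¬ (p ∣ n) → 0 < n
∤⇒positive {p} {zero}  p∤0 = contradiction (p ∣0) p∤0
∤⇒positive {n = suc _} _   = z<s

inverse-mod : ∀ x q → 1 < q → Coprime x q → ∃[ e ] ∃[ u ] e * x ≡ 1 + q * u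
inverse-mod x q 1<q c with coprime-Bézout c
... | Bézout.+- e u eq = e , u , sym (trans (cong suc (ℕ.*-comm q u)) eq)
-- Here `e * x` is -1 modulo the modulus; multiplying by the modulus minus one, which is -1 too,
-- turns it into 1.
inverse-mod x (suc (suc q)) _ c | Bézout.-+ e (suc y) eq =
  e * suc q , y * suc q + q , ℕ.+-cancelʳ-≡ (suc q) _ _ (begin
    e * suc q * x + suc q                             ≡⟨ lem₁ e q x ⟩
    (1 + e * x) * suc q                               ≡⟨ cong (_* suc q) eq ⟩
    suc y * suc (suc q) * suc q                       ≡⟨ lem₂ y q ⟩
    1 + suc (suc q) * (y * suc q + q) + suc q         ∎)
  where
  open ≡-Reasoning
  lem₁ : ∀ e q x → e * (1 + q) * x + (1 + q) ≡ (1 + e * x) * (1 + q)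
  lem₁ = ℕSolver.solve-∀
  lem₂ : ∀ y q → (1 + y) * (2 + q) * (1 + q) ≡ 1 + (2 + q) * (y * (1 + q) + q) + (1 + q)
  lem₂ = ℕSolver.solve-∀
inverse-mod x zero () c | Bézout.-+ e y eq
inverse-mod x (suc zero) (s≤s ()) c | Bézout.-+ e y eq

+-^-mod : ∀ p W j → ∃[ z ] (p + W) ^ j ≡ p ^ j + W * z
+-^-mod p W zero = 0 , sym (cong suc (ℕ.*-zeroʳ W))
+-^-mod p W (suc j) with +-^-mod p W j
... | z , eq = p * z + (p ^ j + W * z) , trans (cong ((p + W) *_) eq) (lem p W (p ^ j) z)
  where
  lem : ∀ p W x z → (p + W) * (x + W * z) ≡ p * x + W * (p * z + (x + W * z))
  lem = ℕSolver.solve-∀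

-- Substitution against dilation

ψ-elim : ∀ {X : Set} (ε : X) b f n (P : X → Set) →
         (∀ q → n ≡ b * q → P (f q)) → (¬ (b ∣ n) → P ε) → P (ψ ε b f n)
ψ-elim ε b f n P y z with b ∣? n
... | yes (divides q eq) = y q (trans eq (ℕ.*-comm q b))
... | no ∤ = z ∤

-- Since `s` is prime to `b`, dilation by `s` neither creates nor destroys divisibility by `b`.
ψ-dilate : ∀ s b .{{_ : NonZero b}} g n → Coprime s b → ψℤ b (λ n → g (s * n)) n ≡ ψℤ b g (s * n)
ψ-dilate s b g n c = ψ-elim 0ℤ b (λ n → g (s * n)) n (_≡ ψℤ b g (s * n))
  (λ { q refl → sym (trans (cong (ψℤ b g) (lem s b q)) (ψ-* 0ℤ b g (s * q))) })
  (λ ∤ → sym (ψ-∤ 0ℤ b g (λ d → ∤ (coprime-divisor (Coprime.sym c) d))))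
  where
  lem : ∀ s b q → s * (b * q) ≡ b * (s * q)
  lem = ℕSolver.solve-∀

-- Both sides are the substitution of z^(p b).
ψ-comm : ∀ p b .{{_ : NonZero p}} .{{_ : NonZero b}} g n → ψℤ p (ψℤ b g) n ≡ ψℤ b (ψℤ p g) n
ψ-comm p b g n with p * b ∣? n
... | yes (divides q refl) = begin
  ψℤ p (ψℤ b g) (q * (p * b)) ≡⟨ cong (ψℤ p (ψℤ b g)) (lem₁ q p b) ⟩
  ψℤ p (ψℤ b g) (p * (b * q)) ≡⟨ trans (ψ-* 0ℤ p (ψℤ b g) (b * q)) (ψ-* 0ℤ b g q) ⟩
  g q                         ≡⟨ sym (trans (ψ-* 0ℤ b (ψℤ p g) (p * q)) (ψ-* 0ℤ p g q)) ⟩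
  ψℤ b (ψℤ p g) (b * (p * q)) ≡⟨ cong (ψℤ b (ψℤ p g)) (lem₂ q p b) ⟩
  ψℤ b (ψℤ p g) (q * (p * b)) ∎
  where
  open ≡-Reasoning
  lem₁ : ∀ q p b → q * (p * b) ≡ p * (b * q)
  lem₁ = ℕSolver.solve-∀
  lem₂ : ∀ q p b → b * (p * q) ≡ q * (p * b)
  lem₂ = ℕSolver.solve-∀
... | no pb∤n = trans (vanish p b pb∤n) (sym (vanish b p (pb∤n ∘ subst (_∣ n) (ℕ.*-comm b p))))
  where
  vanish : ∀ p b → ¬ (p * b ∣ n) → ψℤ p (ψℤ b g) n ≡ 0ℤ
  vanish p b ∤ = ψ-elim 0ℤ p (ψℤ b g) n (_≡ 0ℤ)
    (λ { x refl → ψ-∤ 0ℤ b g (λ d → ∤ (*-monoʳ-∣ p d)) })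
    (λ _ → refl)

-- Periodicity

module Weighted {m : ℕ} (b : Vector ℕ (suc m)) (w : Vector ℤ (suc m))
                (0<b : ∀ i → 0 < b i) where

  instance
    b≢0 : ∀ {i} → NonZero (b i)
    b≢0 {i} = >-nonZero (0<b i)

  -- With `w i = e i * b i` this sends the logarithmic derivative of f to that of ∏ f(z^bᵢ)^eᵢ.
  𝓣 : Series → Series
  𝓣 g n = sum (λ i → w i ℤ.* ψℤ (b i) g n)

  𝓣-dilate : ∀ s → (∀ i → Coprime s (b i)) → ∀ g n → 𝓣 (λ x → g (s * x)) n ≡ 𝓣 g (s * n)
  𝓣-dilate s c g n = sum-cong-≗ (λ i → cong (w i ℤ.*_) (ψ-dilate s (b i) g n (c i)))

  𝓣-ψ : ∀ p .{{_ : NonZero p}} g n → 𝓣 (ψℤ p g) n ≡ ψℤ p (𝓣 g) n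
  𝓣-ψ p g n = trans
    (sum-cong-≗ (λ i → cong (w i ℤ.*_) (sym (ψ-comm p (b i) g n))))
    (ψ-elim 0ℤ p (𝓣 g) n (sum (λ i → w i ℤ.* ψℤ p (ψℤ (b i) g) n) ≡_)
      (λ { q refl → sum-cong-≗ (λ i → cong (w i ℤ.*_) (ψ-* 0ℤ p (ψℤ (b i) g) q)) })
      (λ ∤ → sum-zero (λ i → trans (cong (w i ℤ.*_) (ψ-∤ 0ℤ p (ψℤ (b i) g) ∤)) (ℤ.*-zeroʳ (w i)))))
    where
    sum-zero : ∀ {k} {f : Vector ℤ k} → (∀ i → f i ≡ 0ℤ) → sum f ≡ 0ℤ
    sum-zero {zero}  p = refl
    sum-zero {suc k} p = cong₂ ℤ._+_ (p zero) (sum-zero (p ∘ suc))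

  𝓣-- : ∀ g h n → 𝓣 (λ x → g x ℤ.- h x) n ≡ 𝓣 g n ℤ.- 𝓣 h n
  𝓣-- g h n = trans (sum-cong-≗ ψ--) (sum-- (λ i → w i ℤ.* ψℤ (b i) g n) (λ i → w i ℤ.* ψℤ (b i) h n))
    where
    lem : ∀ w x y → w ℤ.* (x ℤ.- y) ≡ w ℤ.* x ℤ.- w ℤ.* y
    lem = solve-∀
    lem′ : ∀ x y u v → x ℤ.- y ℤ.+ (u ℤ.- v) ≡ x ℤ.+ u ℤ.- (y ℤ.+ v)
    lem′ = solve-∀
    ψ-- : ∀ i → w i ℤ.* ψℤ (b i) (λ x → g x ℤ.- h x) n ≡ w i ℤ.* ψℤ (b i) g n ℤ.- w i ℤ.* ψℤ (b i) h n
    ψ-- i with b i ∣? n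
    ... | yes (divides q _) = lem (w i) (g q) (h q)
    ... | no _ = lem (w i) 0ℤ 0ℤ
    sum-- : ∀ {k} (f g : Vector ℤ k) → sum (λ i → f i ℤ.- g i) ≡ sum f ℤ.- sum g
    sum-- {zero}  f g = refl
    sum-- {suc k} f g = trans (cong (ℤ._+_ (f zero ℤ.- g zero)) (sum-- (f ∘ suc) (g ∘ suc)))
      (lem′ (f zero) (g zero) (sum (f ∘ suc)) (sum (g ∘ suc)))

  module Descent {p : ℕ} (pr : Prime p)
    (b₀<b : ∀ i → b zero < b (suc i))
    (raise-b : ∀ i k {n x} → p ^ k ∣ n → b (suc i) * x ≡ b zero * n → p ^ suc k ∣ x)
    (M : ℕ) (M⊥w₀ : Coprime M ℤ.∣ w zero ∣)
    where

    open Congruence M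

    instance
      p≢0 : NonZero p
      p≢0 = prime⇒nonZero pr

    smaller : ∀ i {n x} → 0 < n → b (suc i) * x ≡ b zero * n → x < n × 0 < x
    smaller i {n} {zero} 0<n eq = contradiction
      (trans (sym eq) (ℕ.*-zeroʳ (b (suc i)))) (ℕ.n>0⇒n≢0 (ℕ.*-mono-≤ (0<b zero) 0<n))
    smaller i {n} {suc x} 0<n eq =
      ℕ.*-cancelˡ-< (b (suc i)) (suc x) n
        (subst (_< b (suc i) * n) (sym eq) (ℕ.*-monoˡ-< n {{>-nonZero 0<n}} (b₀<b i))) , z<s

    -- Evaluate 𝓣 at b₀ n: the other terms involve arguments that are smaller than n
    -- and more divisible by p.
    𝓣-unique : ∀ k {g} → (∀ n → 0 < n → p ^ k ∣ n → 𝓣 g n ≈ 0ℤ) →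
               ∀ n → 0 < n → p ^ k ∣ n → g n ≈ 0ℤ
    𝓣-unique k {g} h = <-rec _ go
      where
      go : ∀ n → (∀ {x} → x < n → 0 < x → p ^ k ∣ x → g x ≈ 0ℤ) →
           0 < n → p ^ k ∣ n → g n ≈ 0ℤ
      go n rec 0<n p^k∣n = *-cancelˡ (w zero) M⊥w₀ (≈-trans
        (+-cancelʳ (≈-trans
            (≈-reflexive (cong (λ x → w zero ℤ.* x ℤ.+ rest) (sym (ψ-* 0ℤ (b zero) g n))))
            (h (b zero * n) (ℕ.*-mono-≤ (0<b zero) 0<n) (∣n⇒∣m*n (b zero) p^k∣n)))
          (sum-≈0 {f = λ i → w (suc i) ℤ.* ψℤ (b (suc i)) g (b zero * n)} (λ i →
            ≈-trans (*-congˡ (w (suc i)) (ψ-elim 0ℤ (b (suc i)) g (b zero * n) (_≈ 0ℤ)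
              (λ q eq → let q<n , 0<q = smaller i 0<n (sym eq) in
                rec q<n 0<q (∣-trans (n∣m*n p) (raise-b i k p^k∣n (sym eq))))
              (λ _ → ≈-refl)))
            (≈-reflexive (ℤ.*-zeroʳ (w (suc i)))))))
        (≈-reflexive (sym (ℤ.*-zeroʳ (w zero)))))
        where rest = sum (λ i → w (suc i) ℤ.* ψℤ (b (suc i)) g (b zero * n))

    -- Positive arguments only: a logarithmic derivative is 0 at 0, whatever a period would demand
    -- there.
    HasPeriod : Series → ℕ → Set
    HasPeriod f R = ∀ n → 0 < n → f (n + R) ≈ f n

    PeriodOn : ℕ → Series → ℕ → Set
    PeriodOn k f S = ∀ n → 0 < n → p ^ k ∣ n → f (n + S) ≈ f n

    period-multiple : ∀ {f R} → HasPeriod f R → ∀ c n → 0 < n → f (n + R * c) ≈ f n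
    period-multiple {f} {R} h c n 0<n =
      shift-multiple {f} {0 <_} R (λ n 0<n → ℕ.≤-trans 0<n (ℕ.m≤m+n n R)) h c n 0<n

    periodOn-multiple : ∀ {k f S} → p ^ k ∣ S → PeriodOn k f S → ∀ c n → 0 < n → p ^ k ∣ n →
                        f (n + S * c) ≈ f n
    periodOn-multiple {k} {f} {S} p^k∣S h c n 0<n p^k∣n =
      shift-multiple {f} {λ n → 0 < n × p ^ k ∣ n} S
        (λ n (0<n , d) → ℕ.≤-trans 0<n (ℕ.m≤m+n n S) , ∣m∣n⇒∣m+n d p^k∣S)
        (λ n (0<n , d) → h n 0<n d) c n (0<n , p^k∣n)

    module _ {B : ℕ} (b∣B : ∀ i → b i ∣ B) where

      -- In the equation at `b zero * n`, moving `n` by `S * B` moves each quotient by `b (suc i)`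
      -- by a multiple of `S`, because `B` clears the denominators. These quotients are divisible by
      -- `p ^ suc k`, where `S` is already a period.
      periodOn-step : ∀ {g R} k S → HasPeriod (𝓣 g) R → R ∣ S → p ^ suc k ∣ S →
                      PeriodOn (suc k) g S → PeriodOn k g (S * B)
      periodOn-step {g} {R} k .(x * R) per (divides x refl) p^∣S on n 0<n p^k∣n =
        *-cancelˡ (w zero) M⊥w₀ (+-cancelʳ (≈-trans
          (≈-reflexive (cong (λ y → w zero ℤ.* y ℤ.+ rest (n + S * B)) (sym (ψ-* 0ℤ (b zero) g (n + S * B)))))
          (≈-trans (≈-trans (≈-reflexive (cong (𝓣 g) (lem₁ (b zero) n x R B)))
            (period-multiple per (x * B * b zero) (b zero * n) (ℕ.*-mono-≤ (0<b zero) 0<n)))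
          (≈-reflexive (cong (λ y → w zero ℤ.* y ℤ.+ rest n) (ψ-* 0ℤ (b zero) g n)))))
          (sum-≈ {f = λ i → w (suc i) ℤ.* ψℤ (b (suc i)) g (b zero * (n + S * B))} (λ i → *-congˡ (w (suc i)) (term i (b∣B (suc i))))))
        where
        S = x * R
        rest : ℕ → ℤ
        rest n = sum (λ i → w (suc i) ℤ.* ψℤ (b (suc i)) g (b zero * n))
        lem₁ : ∀ b n x R B → b * (n + x * R * B) ≡ b * n + R * (x * B * b)
        lem₁ = ℕSolver.solve-∀
        lem₂ : ∀ b₀ b n S c → b₀ * (n + S * (c * b)) ≡ b * (S * (c * b₀)) + b₀ * n
        lem₂ = ℕSolver.solve-∀
        lem₃ : ∀ b q S c → b * (S * c) + b * q ≡ b * (q + S * c)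
        lem₃ = ℕSolver.solve-∀
        term : ∀ i → b (suc i) ∣ B → ψℤ (b (suc i)) g (b zero * (n + S * B)) ≈ ψℤ (b (suc i)) g (b zero * n)
        term i (divides c refl) = ≈-trans (≈-reflexive (cong (ψℤ (b (suc i)) g) (lem₂ (b zero) (b (suc i)) n S c)))
          (ψ-elim 0ℤ (b (suc i)) g (b zero * n) (ψℤ (b (suc i)) g (b (suc i) * (S * (c * b zero)) + b zero * n) ≈_)
            (λ q eq → ≈-trans
              (≈-reflexive (trans (cong (ψℤ (b (suc i)) g)
                  (trans (cong (λ y → b (suc i) * (S * (c * b zero)) + y) eq) (lem₃ (b (suc i)) q S (c * b zero))))
                (ψ-* 0ℤ (b (suc i)) g (q + S * (c * b zero)))))
              (periodOn-multiple {suc k} p^∣S on (c * b zero) q (proj₂ (smaller i 0<n (sym eq))) (raise-b i k p^k∣n (sym eq))))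
            (λ ∤ → ≈-reflexive (ψ-∤ 0ℤ (b (suc i)) g (λ d → ∤ (∣m+n∣m⇒∣n d (m∣m*n (S * (c * b zero))))))))

      -- The divisibility condition is removed one power of `p` at a time, at the cost of a factor
      -- `B` each.
      periodOn⇒hasPeriod : ∀ {g R} k S → HasPeriod (𝓣 g) R → R ∣ S → p ^ k ∣ S →
                           PeriodOn k g S → HasPeriod g (S * B ^ k)
      periodOn⇒hasPeriod {g} zero S per R∣S p^k∣S on n 0<n =
        subst (λ x → g (n + x) ≈ g n) (sym (ℕ.*-identityʳ S)) (on n 0<n (1∣ n))
      periodOn⇒hasPeriod {g} (suc k) S per R∣S p^k∣S on =
        subst (HasPeriod g) (ℕ.*-assoc S B (B ^ k))
          (periodOn⇒hasPeriod k (S * B) per (∣m⇒∣m*n B R∣S)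
            (∣m⇒∣m*n B (∣-trans (n∣m*n p) p^k∣S))
            (periodOn-step k S per R∣S p^k∣S on))

module Periodicity
  {m : ℕ} (b : Vector ℕ (suc m)) (w : Vector ℤ (suc m)) (0<b : ∀ i → 0 < b i)
  {p : ℕ} (pr : Prime p)
  (b₀<b : ∀ i → b zero < b (suc i))
  (raise-b : ∀ i k {n x} → p ^ k ∣ n → b (suc i) * x ≡ b zero * n → p ^ suc k ∣ x)
  (M : ℕ) (M⊥w₀ : Coprime M ℤ.∣ w zero ∣)
  {B : ℕ} (0<B : 0 < B) (b∣B : ∀ i → b i ∣ B)
  where

  open Congruence M
  open Weighted b w 0<b
  open Descent pr b₀<b raise-b M M⊥w₀

  module _ {l : Series} {a τ′ β B′ : ℕ}
    (p∤τ′ : ¬ (p ∣ τ′)) (B≡ : B ≡ p ^ β * B′) (p∤B′ : ¬ (p ∣ B′))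
    (per : HasPeriod (𝓣 l) (p ^ a * τ′)) where

    -- `W` is prime to `p`, yet `W * x` is a multiple of `τ` once `p ^ a` divides `x`. Its factor
    -- `B′` makes every number prime to `p` and to `W` prime to all `b i`; the exponent `suc a` of
    -- `B′` makes `P`, the period found for `l′`, equal to `p ^ c * W`.
    τ W s P c : ℕ
    τ = p ^ a * τ′
    W = τ′ * B′ ^ suc a
    s = p + W
    P = p * τ * B ^ suc a
    c = suc a + β * suc a

    p∤^ : ∀ {x} k → ¬ (p ∣ x) → ¬ (p ∣ x ^ k)
    p∤^ {x} zero    p∤x p∣1 = p∤x (∣-trans p∣1 (1∣ x))
    p∤^ {x} (suc k) p∤x p∣  = [ p∤x , p∤^ k p∤x ]′ (euclidsLemma x (x ^ k) pr p∣)

    p∤* : ∀ {x y} → ¬ (p ∣ x) → ¬ (p ∣ y) → ¬ (p ∣ x * y)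
    p∤* {x} {y} p∤x p∤y p∣ = [ p∤x , p∤y ]′ (euclidsLemma x y pr p∣)

    p∤W : ¬ (p ∣ W)
    p∤W = p∤* p∤τ′ (p∤^ (suc a) p∤B′)

    p∤s : ¬ (p ∣ s)
    p∤s d = p∤W (∣m+n∣m⇒∣n d ∣-refl)

    P≡p^cW : P ≡ p ^ c * W
    P≡p^cW = begin
      p * (p ^ a * τ′) * B ^ suc a                   ≡⟨ cong (λ x → p * (p ^ a * τ′) * x ^ suc a) B≡ ⟩
      p * (p ^ a * τ′) * (p ^ β * B′) ^ suc a        ≡⟨ cong (p * (p ^ a * τ′) *_) (^-distribʳ-* (suc a) (p ^ β) B′) ⟩
      p * (p ^ a * τ′) * ((p ^ β) ^ suc a * B′ ^ suc a) ≡⟨ cong (λ x → p * (p ^ a * τ′) * (x * B′ ^ suc a)) (ℕ.^-*-assoc p β (suc a)) ⟩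
      p * (p ^ a * τ′) * (p ^ (β * suc a) * B′ ^ suc a) ≡⟨ lem p (p ^ a) τ′ (p ^ (β * suc a)) (B′ ^ suc a) ⟩
      p ^ suc a * p ^ (β * suc a) * W                ≡⟨ cong (_* W) (sym (ℕ.^-distribˡ-+-* p (suc a) (β * suc a))) ⟩
      p ^ c * W                                      ∎
      where
      open ≡-Reasoning
      lem : ∀ p x t y z → p * (x * t) * (y * z) ≡ p * x * y * (t * z)
      lem = ℕSolver.solve-∀

    coprime-b : ∀ {x} → Coprime x p → Coprime x W → ∀ i → Coprime x (b i)
    coprime-b {x} x⊥p x⊥W i = coprime-∣ (b∣B i) (subst (Coprime x) (sym B≡)
      (coprime-* (coprime-^ β x⊥p) (coprime-∣ (∣n⇒∣m*n τ′ (m∣m*n (B′ ^ a))) x⊥W)))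

    s⊥b : ∀ i → Coprime s (b i)
    s⊥b = coprime-b (prime∤⇒coprime pr p∤s) s⊥W
      where
      s⊥W : Coprime s W
      s⊥W {d} (d∣s , d∣W) = prime∤⇒coprime pr p∤W (d∣W , ∣m+n∣m⇒∣n (subst (d ∣_) (ℕ.+-comm p W) d∣s) d∣W)

    -- s ≡ p modulo W, but s is prime to every b i: so dilation by s commutes with 𝓣, and
    -- 𝓣 l (p n) ≈ 𝓣 l (s n) when p^a ∣ n.
    l′ : Series
    l′ n = l n ℤ.- ψℤ p (λ x → l (s * x)) n

    𝓣l′ : ∀ n → 𝓣 l′ n ≡ 𝓣 l n ℤ.- ψℤ p (λ x → 𝓣 l (s * x)) n
    𝓣l′ n = trans (𝓣-- l (ψℤ p (λ x → l (s * x))) n) (cong (λ x → 𝓣 l n ℤ.- x)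
      (trans (𝓣-ψ p (λ x → l (s * x)) n) (ψ-cong 0ℤ p (𝓣-dilate s s⊥b l) n)))

    0<s : 0 < s
    0<s = ℕ.≤-trans (>-nonZero⁻¹ p) (ℕ.m≤m+n p W)

    positive-factor : ∀ x {y} → 0 < x * y → 0 < y
    positive-factor x {zero}  0<xy = contradiction (ℕ.*-zeroʳ x) (ℕ.n>0⇒n≢0 0<xy)
    positive-factor x {suc y} _ = z<s

    𝓣l′-vanishes : ∀ n → 0 < n → p ^ suc a ∣ n → 𝓣 l′ n ≈ 0ℤ
    𝓣l′-vanishes .(y * p ^ suc a) 0<n (divides y refl) =
      ≈-trans (≈-reflexive (𝓣l′ n)) (≈-trans
        (≈-reflexive (cong₂ ℤ._-_ (cong (𝓣 l) n≡) (trans (cong (ψℤ p 𝓣l∘s) n≡) (ψ-* 0ℤ p 𝓣l∘s (p ^ a * y)))))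
        (≈-trans (-‿cong (≈-sym (period-multiple per (B′ ^ suc a * y) (p * (p ^ a * y)) (subst (0 <_) n≡ 0<n)))
                         (≈-reflexive (cong (𝓣 l) (lem′ p τ′ (B′ ^ suc a) (p ^ a) y))))
          (≈-reflexive (ℤ.+-inverseʳ (𝓣 l (p * (p ^ a * y) + τ * (B′ ^ suc a * y)))))))
      where
      n = y * p ^ suc a
      𝓣l∘s : Series
      𝓣l∘s x = 𝓣 l (s * x)
      n≡ : n ≡ p * (p ^ a * y)
      n≡ = lem y p (p ^ a)
        where
        lem : ∀ y p x → y * (p * x) ≡ p * (x * y)
        lem = ℕSolver.solve-∀
      lem′ : ∀ p t z x y → (p + t * z) * (x * y) ≡ p * (x * y) + x * t * (z * y)
      lem′ = ℕSolver.solve-∀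

    𝓣l′-periodic : HasPeriod (𝓣 l′) (p * τ)
    𝓣l′-periodic n 0<n = ≈-trans (≈-reflexive (𝓣l′ (n + p * τ))) (≈-trans
      (-‿cong (subst (λ x → 𝓣 l (n + x) ≈ 𝓣 l n) (ℕ.*-comm τ p) (period-multiple per p n 0<n)) shift)
      (≈-reflexive (sym (𝓣l′ n))))
      where
      𝓣l∘s : Series
      𝓣l∘s x = 𝓣 l (s * x)
      shift : ψℤ p 𝓣l∘s (n + p * τ) ≈ ψℤ p 𝓣l∘s n
      shift = ψ-elim 0ℤ p 𝓣l∘s n (ψℤ p 𝓣l∘s (n + p * τ) ≈_)
        (λ { q refl → ≈-trans
          (≈-reflexive (trans (cong (ψℤ p 𝓣l∘s) (sym (ℕ.*-distribˡ-+ p q τ)))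
            (trans (ψ-* 0ℤ p 𝓣l∘s (q + τ))
              (cong (𝓣 l) (trans (ℕ.*-distribˡ-+ s q τ) (cong (λ x → s * q + x) (ℕ.*-comm s τ)))))))
          (period-multiple per s (s * q) (ℕ.*-mono-≤ 0<s (positive-factor p 0<n))) })
        (λ ∤ → ≈-reflexive (ψ-∤ 0ℤ p 𝓣l∘s
          (λ d → ∤ (∣m+n∣m⇒∣n (subst (p ∣_) (ℕ.+-comm n (p * τ)) d) (m∣m*n τ)))))

    l′-vanishes : ∀ n → 0 < n → p ^ suc a ∣ n → l′ n ≈ 0ℤ
    l′-vanishes = 𝓣-unique (suc a) 𝓣l′-vanishes

    p^a+1∣pτ : p ^ suc a ∣ p * τ
    p^a+1∣pτ = *-monoʳ-∣ p (m∣m*n τ′)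

    -- On multiples of `p ^ suc a` the series vanishes modulo `M`, so it is trivially periodic
    -- there: this is the start that the descent needs.
    l′-periodic : HasPeriod l′ P
    l′-periodic = periodOn⇒hasPeriod b∣B (suc a) (p * τ) 𝓣l′-periodic ∣-refl p^a+1∣pτ
      (λ n 0<n d → ≈-trans
        (l′-vanishes (n + p * τ) (ℕ.≤-trans 0<n (ℕ.m≤m+n n _)) (∣m∣n⇒∣m+n d p^a+1∣pτ))
        (≈-sym (l′-vanishes n 0<n d)))

    l-p : ∀ n → 0 < n → p ^ a ∣ n → l (p * n) ≈ l (s * n)
    l-p n 0<n d = ≈-trans (≈-reflexive (x≡x-y+y (l (p * n)) (l (s * n)))) (≈-trans
      (+-cong (≈-trans (≈-reflexive (cong (λ x → l (p * n) ℤ.- x) (sym (ψ-* 0ℤ p (λ x → l (s * x)) n))))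
        (l′-vanishes (p * n) (ℕ.*-mono-≤ (>-nonZero⁻¹ p) 0<n) (*-monoʳ-∣ p d))) ≈-refl)
      (≈-reflexive (ℤ.+-identityˡ (l (s * n)))))

    p∣P : p ∣ P
    p∣P = ∣m⇒∣m*n (B ^ suc a) (m∣m*n τ)

    -- By definition of `l′`, l(n) is l′(n) plus, if `p` divides `n`, l(s n/p). Passing to s n/p
    -- lowers the exponent of `p` by one, as `p` does not divide `s`, and turns the shift by
    -- `p ^ suc j * P * k` into one by `p ^ j * P * (s * k)`.
    l-low : ∀ j n k → 0 < n → ¬ (p ^ suc j ∣ n) → l (n + p ^ j * P * k) ≈ l n
    l-low j n k 0<n ∤ = ≈-trans (≈-reflexive (x≡x-y+y (l (n + S)) (ψℤ p l∘s (n + S)))) (≈-trans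
      (+-cong (subst (λ x → l′ (n + x) ≈ l′ n) (lem′ P (p ^ j) k) (period-multiple l′-periodic (p ^ j * k) n 0<n))
              (shift j ∤))
      (≈-reflexive (sym (x≡x-y+y (l n) (ψℤ p l∘s n)))))
      where
      S = p ^ j * P * k
      l∘s : Series
      l∘s x = l (s * x)
      lem′ : ∀ P x k → P * (x * k) ≡ x * P * k
      lem′ = ℕSolver.solve-∀
      shift : ∀ j → ¬ (p ^ suc j ∣ n) → ψℤ p l∘s (n + p ^ j * P * k) ≈ ψℤ p l∘s n
      shift j ∤ with p ∣? n
      shift zero ∤ | yes d = contradiction (subst (_∣ n) (sym (ℕ.*-identityʳ p)) d) ∤
      shift (suc j) ∤ | yes (divides q refl) = ≈-trans
        (≈-reflexive (trans (cong (ψℤ p l∘s) (lem₁ q p (p ^ j) P k))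
          (trans (ψ-* 0ℤ p l∘s (q + p ^ j * P * k)) (cong l (lem₂ s q (p ^ j) P k)))))
        (l-low j (s * q) (s * k) (ℕ.*-mono-≤ 0<s (positive-factor p (subst (0 <_) (ℕ.*-comm q p) 0<n)))
          (λ d → ∤ (subst (p ^ suc (suc j) ∣_) (ℕ.*-comm p q) (*-monoʳ-∣ p (p^k∣-cancelˡ pr (suc j) p∤s d)))))
        where
        lem₁ : ∀ q p x P k → q * p + p * x * P * k ≡ p * (q + x * P * k)
        lem₁ = ℕSolver.solve-∀
        lem₂ : ∀ s q x P k → s * (q + x * P * k) ≡ s * q + x * P * (s * k)
        lem₂ = ℕSolver.solve-∀
      shift j ∤ | no p∤n = ≈-reflexive (ψ-∤ 0ℤ p l∘s
        (λ d → p∤n (∣m+n∣m⇒∣n (subst (p ∣_) (ℕ.+-comm n (p ^ j * P * k)) d) (∣m⇒∣m*n k (∣n⇒∣m*n (p ^ j) p∣P)))))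

    -- The factor `p ^ a` is kept in front so that `l-p` applies each time a `p` is traded for an
    -- `s`.
    l-power : ∀ j u → 0 < u → l (p ^ a * (p ^ j * u)) ≈ l (p ^ a * (s ^ j * u))
    l-power zero    u 0<u = ≈-refl
    l-power (suc j) u 0<u = ≈-trans
      (≈-reflexive (cong l (lem₁ p (p ^ a) (p ^ j) u)))
      (≈-trans (l-p (p ^ a * (p ^ j * u)) 0<n (m∣m*n _)) (≈-trans
        (≈-reflexive (cong l (lem₂ s (p ^ a) (p ^ j) u)))
        (≈-trans (l-power j (s * u) (ℕ.*-mono-≤ 0<s 0<u)) (≈-reflexive (cong l (lem₃ s (p ^ a) (s ^ j) u))))))
      where
      0<p^ : ∀ k → 0 < p ^ k
      0<p^ k = ℕ.m^n>0 p k
      0<n : 0 < p ^ a * (p ^ j * u)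
      0<n = ℕ.*-mono-≤ (0<p^ a) (ℕ.*-mono-≤ (0<p^ j) 0<u)
      lem₁ : ∀ p x y u → x * (p * y * u) ≡ p * (x * (y * u))
      lem₁ = ℕSolver.solve-∀
      lem₂ : ∀ s x y u → s * (x * (y * u)) ≡ x * (y * (s * u))
      lem₂ = ℕSolver.solve-∀
      lem₃ : ∀ s x y u → x * (y * (s * u)) ≡ x * (s * y * u)
      lem₃ = ℕSolver.solve-∀

    -- The multiplier is prime to `W` by its form and to `p` by hypothesis, hence to every `b i`, so
    -- this dilation commutes with `𝓣`. On multiples of `p ^ a` it moves the argument by a multiple
    -- of `τ`, so `𝓣-unique` applies to the difference.
    l-dilate : ∀ α → ¬ (p ∣ 1 + W * α) → ∀ n → 0 < n → p ^ a ∣ n → l ((1 + W * α) * n) ≈ l n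
    l-dilate α p∤ n 0<n d = ≈-trans (≈-reflexive (x≡x-y+y (l (σ * n)) (l n))) (≈-trans
      (+-cong (𝓣-unique a {g} vanish n 0<n d) (≈-refl {l n})) (≈-reflexive (ℤ.+-identityˡ (l n))))
      where
      σ = 1 + W * α
      g : Series
      g n = l (σ * n) ℤ.- l n
      σ⊥W : Coprime σ W
      σ⊥W {d} (d∣σ , d∣W) = ∣1⇒≡1 (∣m+n∣m⇒∣n (subst (d ∣_) (ℕ.+-comm 1 (W * α)) d∣σ) (∣m⇒∣m*n α d∣W))
      lem′ : ∀ t z α y x → (1 + t * z * α) * (y * x) ≡ y * x + x * t * (z * α * y)
      lem′ = ℕSolver.solve-∀
      vanish : ∀ n → 0 < n → p ^ a ∣ n → 𝓣 g n ≈ 0ℤ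
      vanish n 0<n (divides y refl) = ≈-trans
        (≈-reflexive (trans (𝓣-- (λ x → l (σ * x)) l n)
          (cong (λ x → x ℤ.- 𝓣 l n) (trans (𝓣-dilate σ (coprime-b (prime∤⇒coprime pr p∤) σ⊥W) l n)
            (cong (𝓣 l) (lem′ τ′ (B′ ^ suc a) α y (p ^ a)))))))
        (≈-trans (-‿cong (period-multiple per (B′ ^ suc a * α * y) n 0<n) (≈-refl {𝓣 l n}))
          (≈-reflexive (ℤ.+-inverseʳ (𝓣 l n))))

    -- A multiplier ≡ 1 modulo W takes x to x + W k modulo P.
    l-unit : ∀ x k → 0 < x → ¬ (p ∣ x) → ¬ (p ∣ x + W * k) → l (p ^ a * (x + W * k)) ≈ l (p ^ a * x)
    l-unit x k 0<x p∤x p∤x+Wk with inverse-mod x (p ^ c) 1<p^c (coprime-^ c (prime∤⇒coprime pr p∤x))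
      where
      1<p^c : 1 < p ^ c
      1<p^c = ℕ.≤-trans (nonTrivial⇒n>1 p {{prime⇒nonTrivial pr}})
        (ℕ.m≤m*n p (p ^ (a + β * suc a)) {{ℕ.m^n≢0 p (a + β * suc a)}})
    ... | e , u , ex≡ = ≈-trans (≈-sym low) (≈-trans
          (≈-reflexive (cong l (trans (cong (p ^ a *_) (sym σx≡)) (lem₃ (p ^ a) (1 + W * (e * k)) x))))
          (l-dilate (e * k) p∤σ (p ^ a * x) (ℕ.*-mono-≤ (ℕ.m^n>0 p a) 0<x) (m∣m*n x)))
      where
      open ≡-Reasoning
      lem₁ : ∀ x W e k → (1 + W * (e * k)) * x ≡ x + W * k * (e * x)
      lem₁ = ℕSolver.solve-∀
      lem₂ : ∀ x W k q u → x + W * k * (1 + q * u) ≡ x + W * k + q * W * (k * u)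
      lem₂ = ℕSolver.solve-∀
      lem₃ : ∀ y σ x → y * (σ * x) ≡ σ * (y * x)
      lem₃ = ℕSolver.solve-∀
      lem₄ : ∀ y x z → y * (x + z) ≡ y * x + y * z
      lem₄ = ℕSolver.solve-∀
      σx≡ : (1 + W * (e * k)) * x ≡ x + W * k + P * (k * u)
      σx≡ = begin
        (1 + W * (e * k)) * x                  ≡⟨ lem₁ x W e k ⟩
        x + W * k * (e * x)                    ≡⟨ cong (λ y → x + W * k * y) ex≡ ⟩
        x + W * k * (1 + p ^ c * u)            ≡⟨ lem₂ x W k (p ^ c) u ⟩
        x + W * k + p ^ c * W * (k * u)        ≡⟨ cong (λ y → x + W * k + y * (k * u)) (sym P≡p^cW) ⟩
        x + W * k + P * (k * u)                ∎
      p∤σ : ¬ (p ∣ 1 + W * (e * k))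
      p∤σ d = p∤x+Wk (∣m+n∣m⇒∣n (subst (p ∣_) (trans σx≡ (ℕ.+-comm _ (P * (k * u)))) (∣m⇒∣m*n x d)) (∣m⇒∣m*n (k * u) p∣P))
      -- The inverse of `x` was taken only modulo `p ^ c`, which leaves an excess `P * (k * u)`. It
      -- is harmless because `x + W * k` is prime to `p`, so that `p ^ a * (x + W * k)` has exponent
      -- exactly `a`.
      low : l (p ^ a * (x + W * k + P * (k * u))) ≈ l (p ^ a * (x + W * k))
      low = ≈-trans
        (≈-reflexive (cong l (trans (lem₄ (p ^ a) (x + W * k) (P * (k * u)))
          (cong (λ y → p ^ a * (x + W * k) + y) (sym (ℕ.*-assoc (p ^ a) P (k * u)))))))
        (l-low a (p ^ a * (x + W * k)) (k * u)
          (ℕ.*-mono-≤ (ℕ.m^n>0 p a) (ℕ.≤-trans 0<x (ℕ.m≤m+n x (W * k))))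
          (λ d → p∤x+Wk (*-cancelˡ-∣ (p ^ a) {{ℕ.m^n≢0 p a}} (subst (_∣ p ^ a * (x + W * k)) (ℕ.*-comm p (p ^ a)) d))))

    -- The cofactors `k` and `k + W` may contain different powers of `p`. Trading these for powers
    -- of `s` gives two numbers prime to `p` that are still congruent to `k` modulo `W`, and
    -- `l-unit` compares those.
    l-top : PeriodOn a l (p ^ a * W)
    l-top n 0<n (divides k refl) with p-part pr k 0<k | p-part pr (k + W) (ℕ.≤-trans 0<k (ℕ.m≤m+n k W))
      where
      0<k = positive-factor (p ^ a) (subst (0 <_) (ℕ.*-comm k (p ^ a)) 0<n)
    ... | j , u , k≡ , p∤u | i , v , k+W≡ , p∤v with +-^-mod p W j | +-^-mod p W i
    ... | z₁ , s^j≡ | z₂ , s^i≡ = ≈-trans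
      (≈-reflexive (cong l (trans (lem₁ k (p ^ a) W) (cong (p ^ a *_) k+W≡))))
      (≈-trans (l-power i v 0<v) (≈-trans (compare (ℕ.≤-total (z₁ * u) (1 + z₂ * v)))
      (≈-trans (≈-sym (l-power j u 0<u)) (≈-reflexive (cong l (trans (cong (p ^ a *_) (sym k≡)) (ℕ.*-comm (p ^ a) k)))))))
      where
      lem₁ : ∀ k x W → k * x + x * W ≡ x * (k + W)
      lem₁ = ℕSolver.solve-∀
      lem₂ : ∀ x W z u → (x + W * z) * u ≡ x * u + W * (z * u)
      lem₂ = ℕSolver.solve-∀
      lem₃ : ∀ k W z → k + W + W * z ≡ k + W * (1 + z)
      lem₃ = ℕSolver.solve-∀
      0<u = ∤⇒positive p∤u
      0<v = ∤⇒positive p∤v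
      x≡ : s ^ j * u ≡ k + W * (z₁ * u)
      x≡ = trans (cong (_* u) s^j≡) (trans (lem₂ (p ^ j) W z₁ u) (cong (λ y → y + W * (z₁ * u)) (sym k≡)))
      y≡ : s ^ i * v ≡ k + W * (1 + z₂ * v)
      y≡ = trans (cong (_* v) s^i≡) (trans (lem₂ (p ^ i) W z₂ v)
        (trans (cong (λ y → y + W * (z₂ * v)) (sym k+W≡)) (lem₃ k W (z₂ * v))))
      shifted : ∀ {x y α γ} → α ≤ γ → x ≡ k + W * α → y ≡ k + W * γ → ∃[ κ ] y ≡ x + W * κ
      shifted {α = α} {γ} α≤γ refl refl = γ ∸ α ,
        trans (cong (λ y → k + W * y) (sym (ℕ.m+[n∸m]≡n α≤γ))) (lem k W α (γ ∸ α))
        where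
        lem : ∀ k W α δ → k + W * (α + δ) ≡ k + W * α + W * δ
        lem = ℕSolver.solve-∀
      p∤x = p∤* (p∤^ j p∤s) p∤u
      p∤y = p∤* (p∤^ i p∤s) p∤v
      close : ∀ {x y} → ¬ (p ∣ x) → ¬ (p ∣ y) → ∃[ κ ] y ≡ x + W * κ → l (p ^ a * y) ≈ l (p ^ a * x)
      close {x} p∤x p∤y (κ , refl) = l-unit x κ (∤⇒positive p∤x) p∤x p∤y
      compare : z₁ * u ≤ 1 + z₂ * v ⊎ 1 + z₂ * v ≤ z₁ * u → l (p ^ a * (s ^ i * v)) ≈ l (p ^ a * (s ^ j * u))
      compare (inj₁ le) = close p∤x p∤y (shifted le x≡ y≡)
      compare (inj₂ ge) = ≈-sym (close p∤y p∤x (shifted ge y≡ x≡))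

    l-periodic : HasPeriod l (p ^ a * W * B ^ a)
    l-periodic = periodOn⇒hasPeriod b∣B a (p ^ a * W) per
      (*-monoʳ-∣ (p ^ a) (m∣m*n (B′ ^ suc a))) (m∣m*n W) l-top

  periodic : ∀ {l τ} → 0 < τ → HasPeriod (𝓣 l) τ →
             ∃[ W ] (0 < W × W ≤ τ * (B * (τ ^ B * τ ^ B)) × HasPeriod l W)
  periodic {l} {τ} 0<τ per with p-part pr τ 0<τ | p-part pr B 0<B
  ... | a , τ′ , refl , p∤τ′ | β , B′ , refl , p∤B′ =
    p ^ a * (τ′ * B′ ^ suc a) * B ^ a , 0<W , W≤ , l-periodic {l} {a} {τ′} {β} {B′} p∤τ′ refl p∤B′ per
    where
    n<p^n : ∀ n → n < p ^ n
    n<p^n zero = z<s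
    n<p^n (suc n) = ℕ.≤-trans (s≤s (n<p^n n))
      (subst (p ^ n <_) (ℕ.*-comm (p ^ n) p) (ℕ.m<m*n (p ^ n) p {{ℕ.m^n≢0 p n}} (nonTrivial⇒n>1 p {{prime⇒nonTrivial pr}})))
    0<W : 0 < p ^ a * (τ′ * B′ ^ suc a) * B ^ a
    0<W = ℕ.*-mono-≤ (ℕ.*-mono-≤ (ℕ.m^n>0 p a) (ℕ.*-mono-≤ (∤⇒positive p∤τ′) (ℕ.m^n>0 B′ {{>-nonZero (∤⇒positive p∤B′)}} (suc a))))
      (ℕ.m^n>0 B {{>-nonZero 0<B}} a)
    -- This makes the loss over `a` descent steps polynomial: `B ≤ p ^ B` lets base and exponent
    -- change places, and `p ^ a` divides the period.
    B^a≤ : B ^ a ≤ (p ^ a * τ′) ^ B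
    B^a≤ = begin
      B ^ a               ≤⟨ ℕ.^-monoˡ-≤ a (ℕ.<⇒≤ (n<p^n B)) ⟩
      (p ^ B) ^ a         ≡⟨ trans (ℕ.^-*-assoc p B a) (trans (cong (p ^_) (ℕ.*-comm B a)) (sym (ℕ.^-*-assoc p a B))) ⟩
      (p ^ a) ^ B         ≤⟨ ℕ.^-monoˡ-≤ B (ℕ.m≤m*n (p ^ a) τ′ {{>-nonZero (∤⇒positive p∤τ′)}}) ⟩
      (p ^ a * τ′) ^ B    ∎
      where open ℕ.≤-Reasoning
    lem : ∀ x t y z → x * (t * y) * z ≡ x * t * (y * z)
    lem = ℕSolver.solve-∀
    lem′ : ∀ x y → x * y * y ≡ x * (y * y)
    lem′ = ℕSolver.solve-∀
    B′≤B : B′ ≤ B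
    B′≤B = ℕ.m≤n*m B′ (p ^ β) {{ℕ.m^n≢0 p β}}
    W≤ : p ^ a * (τ′ * B′ ^ suc a) * B ^ a ≤ p ^ a * τ′ * (B * ((p ^ a * τ′) ^ B * (p ^ a * τ′) ^ B))
    W≤ = begin
      p ^ a * (τ′ * B′ ^ suc a) * B ^ a        ≡⟨ lem (p ^ a) τ′ (B′ ^ suc a) (B ^ a) ⟩
      p ^ a * τ′ * (B′ ^ suc a * B ^ a)        ≤⟨ ℕ.*-monoʳ-≤ (p ^ a * τ′) (ℕ.*-monoˡ-≤ (B ^ a) (ℕ.^-monoˡ-≤ (suc a) B′≤B)) ⟩
      p ^ a * τ′ * (B * B ^ a * B ^ a)         ≡⟨ cong (p ^ a * τ′ *_) (lem′ B (B ^ a)) ⟩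
      p ^ a * τ′ * (B * (B ^ a * B ^ a))       ≤⟨ ℕ.*-monoʳ-≤ (p ^ a * τ′) (ℕ.*-monoʳ-≤ B (ℕ.*-mono-≤ B^a≤ B^a≤)) ⟩
      p ^ a * τ′ * (B * ((p ^ a * τ′) ^ B * (p ^ a * τ′) ^ B)) ∎
      where open ℕ.≤-Reasoning

-- Linear recurrences modulo M

-- Coefficient `d + n` of `q ⊛ g` when `q` is a polynomial of degree at most `d`.
segment : ℕ → Series → Series → ℕ → ℤ
segment zero    q g n = q 0 ℤ.* g n
segment (suc d) q g n = q 0 ℤ.* g (suc d + n) ℤ.+ segment d (q ∘ suc) g n

⊛-segment : ∀ d {q} g n → (∀ k → d < k → q k ≡ 0ℤ) → (q ⊛ g) (d + n) ≡ segment d q g n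
⊛-segment zero    {q} g n h = ⊛-const {q} g n (λ k _ → h (suc k) z<s)
⊛-segment (suc d) {q} g n h =
  cong (ℤ._+_ (q 0 ℤ.* g (suc d + n))) (⊛-segment d g n (λ k d<k → h (suc k) (s<s d<k)))

module _ (M : ℕ) where
  open Congruence M

  segment-cong : ∀ d q g {n n′} → (∀ i → i ≤ d → g (i + n) ≈ g (i + n′)) → segment d q g n ≈ segment d q g n′
  segment-cong zero    q g h = *-congˡ (q 0) (h 0 z≤n)
  segment-cong (suc d) q g h =
    +-cong (*-congˡ (q 0) (h (suc d) ℕ.≤-refl)) (segment-cong d (q ∘ suc) g (λ i i≤d → h i (ℕ.m≤n⇒m≤1+n i≤d)))

  segment-top : ∀ d q g {n n′} → q 0 ≡ 1ℤ → (∀ i → i < d → g (i + n) ≈ g (i + n′)) →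
                segment d q g n ≈ segment d q g n′ → g (d + n) ≈ g (d + n′)
  segment-top d q g {n} {n′} q₀ h eq = ≈-trans (≈-reflexive (q₀g (g (d + n))))
    (≈-trans (top d h eq) (≈-reflexive (sym (q₀g (g (d + n′))))))
    where
    q₀g : ∀ x → x ≡ q 0 ℤ.* x
    q₀g x = trans (sym (ℤ.*-identityˡ x)) (cong (ℤ._* x) (sym q₀))
    top : ∀ d → (∀ i → i < d → g (i + n) ≈ g (i + n′)) → segment d q g n ≈ segment d q g n′ →
          q 0 ℤ.* g (d + n) ≈ q 0 ℤ.* g (d + n′)
    top zero    h eq = eq
    top (suc d) h eq = +-cancelʳ eq (segment-cong d (q ∘ suc) g (λ i i≤d → h i (s≤s i≤d)))

  -- Runs the recurrence backwards, as `segment-top` runs it forwards. The oldest value is recovered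
  -- only up to the factor `q d`.
  segment-bottom : ∀ d q g {n n′} → (∀ i → i < d → g (suc i + n) ≈ g (suc i + n′)) →
                   segment d q g n ≈ segment d q g n′ → q d ℤ.* g n ≈ q d ℤ.* g n′
  segment-bottom zero    q g h eq = eq
  segment-bottom (suc d) q g {n} {n′} h eq = segment-bottom d (q ∘ suc) g
    (λ i i<d → h i (ℕ.m<n⇒m<1+n i<d))
    (+-cancelʳ {segment d (q ∘ suc) g n} {segment d (q ∘ suc) g n′}
      {q 0 ℤ.* g (suc d + n)} {q 0 ℤ.* g (suc d + n′)}
      (subst₂ _≈_ (ℤ.+-comm (q 0 ℤ.* g (suc d + n)) (segment d (q ∘ suc) g n))
                  (ℤ.+-comm (q 0 ℤ.* g (suc d + n′)) (segment d (q ∘ suc) g n′)) eq)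
      (*-congˡ (q 0) (h d ℕ.≤-refl)))

  residue : .{{_ : NonZero M}} → ℤ → Fin M
  residue x = fromℕ< (n%ℕd<d x M)

  residue-≈ : .{{_ : NonZero M}} → ∀ {x y} → residue x ≡ residue y → x ≈ y
  residue-≈ {x} {y} eq = mod (ℤ∣.divides (x /ℕ M ℤ.- y /ℕ M) (begin
    x ℤ.- y
      ≡⟨ cong₂ ℤ._-_ (a≡a%ℕn+[a/ℕn]*n x M) (a≡a%ℕn+[a/ℕn]*n y M) ⟩
    + (x %ℕ M) ℤ.+ x /ℕ M ℤ.* + M ℤ.- (+ (y %ℕ M) ℤ.+ y /ℕ M ℤ.* + M)
      ≡⟨ cong (λ r → + r ℤ.+ x /ℕ M ℤ.* + M ℤ.- (+ (y %ℕ M) ℤ.+ y /ℕ M ℤ.* + M)) r≡ ⟩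
    + (y %ℕ M) ℤ.+ x /ℕ M ℤ.* + M ℤ.- (+ (y %ℕ M) ℤ.+ y /ℕ M ℤ.* + M)
      ≡⟨ lem (+ (y %ℕ M)) (x /ℕ M) (y /ℕ M) (+ M) ⟩
    (x /ℕ M ℤ.- y /ℕ M) ℤ.* + M ∎))
    where
    open ≡-Reasoning
    r≡ : x %ℕ M ≡ y %ℕ M
    r≡ = trans (sym (Fin.toℕ-fromℕ< (n%ℕd<d x M))) (trans (cong toℕ eq) (Fin.toℕ-fromℕ< (n%ℕd<d y M)))
    lem : ∀ r u v m → r ℤ.+ u ℤ.* m ℤ.- (r ℤ.+ v ℤ.* m) ≡ (u ℤ.- v) ℤ.* m
    lem = solve-∀

  module Recurrence .{{_ : NonZero M}} {d : ℕ} {q D : Series} {c : ℤ}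
    (q₀ : q 0 ≡ 1ℤ) (M⊥q : Coprime M ℤ.∣ q d ∣)
    (rec : ∀ n → segment d q D (suc n) ≡ c) where

    SameState : ℕ → ℕ → Set
    SameState n n′ = ∀ i → i < d → D (i + suc n) ≈ D (i + suc n′)

    same-segment : ∀ n n′ → segment d q D (suc n) ≈ segment d q D (suc n′)
    same-segment n n′ = ≈-reflexive (trans (rec n) (sym (rec n′)))

    same-next : ∀ {n n′} → SameState n n′ → ∀ i → i ≤ d → D (i + suc n) ≈ D (i + suc n′)
    same-next {n} {n′} h i i≤d with ℕ.m≤n⇒m<n∨m≡n i≤d
    ... | inj₁ i<d  = h i i<d
    ... | inj₂ refl = segment-top d q D q₀ h (same-segment n n′)

    same-suc : ∀ {n n′} → SameState n n′ → SameState (suc n) (suc n′)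
    same-suc {n} {n′} h i i<d = subst₂ (λ x y → D x ≈ D y) (sym (ℕ.+-suc i (suc n))) (sym (ℕ.+-suc i (suc n′)))
      (same-next h (suc i) i<d)

    -- Coprimality of `M` to `q d` makes the recurrence reversible, so a coincidence of states can
    -- be carried back to the start and there is no preperiod.
    same-pred : ∀ {n n′} → SameState (suc n) (suc n′) → SameState n n′
    same-pred {n} {n′} h = go
      where
      above : ∀ i → i < d → D (suc i + suc n) ≈ D (suc i + suc n′)
      above i i<d = subst₂ (λ x y → D x ≈ D y) (ℕ.+-suc i (suc n)) (ℕ.+-suc i (suc n′)) (h i i<d)
      go : SameState n n′
      go zero    i<d = *-cancelˡ (q d) M⊥q (segment-bottom d q D above (same-segment n n′))
      go (suc i) i<d = above i (ℕ.<-trans ℕ.≤-refl i<d)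

    same-zero : ∀ n τ → SameState n (n + τ) → SameState 0 τ
    same-zero zero    τ h = h
    same-zero (suc n) τ h = same-zero n τ (same-pred h)

    same-all : ∀ n τ → SameState 0 τ → SameState n (n + τ)
    same-all zero    τ h = h
    same-all (suc n) τ h = same-suc (same-all n τ h)

    state : ℕ → Fin (M ^ d)
    state n = funToFin {d} (λ i → residue (D (toℕ i + suc n)))

    state-same : ∀ {n n′} → state n ≡ state n′ → SameState n n′
    state-same {n} {n′} eq i i<d = subst (λ k → D (k + suc n) ≈ D (k + suc n′)) (Fin.toℕ-fromℕ< i<d)
      (residue-≈ (trans (sym (Fin.finToFun-funToFin {d} {M} (λ i → residue (D (toℕ i + suc n))) j))
        (trans (cong (λ s → finToFun {M} {d} s j) eq) (Fin.finToFun-funToFin {d} {M} (λ i → residue (D (toℕ i + suc n′))) j))))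
      where j = fromℕ< i<d

    -- A state consists of `d` residues, with `d` independent of `M`; hence a bound polynomial in
    -- `M`.
    recurrence-periodic : ∃[ τ ] (0 < τ × τ ≤ M ^ d × (∀ n → 0 < n → D (n + τ) ≈ D n))
    recurrence-periodic with Fin.pigeonhole (ℕ.n<1+n (M ^ d)) (λ i → state (toℕ i))
    ... | i , j , i<j , eq = τ , ℕ.m<n⇒0<n∸m i<j , τ≤ , periodic
      where
      τ = toℕ j ∸ toℕ i
      τ≤ : τ ≤ M ^ d
      τ≤ = ℕ.≤-trans (ℕ.m∸n≤m (toℕ j) (toℕ i)) (Fin.toℕ≤pred[n] j)
      same₀ : SameState 0 τ
      same₀ = same-zero (toℕ i) τ (subst (SameState (toℕ i)) (sym (ℕ.m+[n∸m]≡n (ℕ.<⇒≤ i<j))) (state-same eq))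
      periodic : ∀ n → 0 < n → D (n + τ) ≈ D n
      periodic (suc n) _ = ≈-sym (same-next (same-all n τ same₀) 0 z≤n)

-- Multiplying `ϑ F = F ⊛ D` by 1 - z gives `∇ F ⊛ D` as the differences of n F(n), which are `c`
-- where `F` is constant. The argument `suc n` keeps both differenced indices at least `d`.
segment-logDerivative : ∀ {F D c d} → LogDerivative F D → (∀ n → d ≤ n → F n ≡ c) →
                        ∀ n → segment d (∇ F) D (suc n) ≡ c
segment-logDerivative {F} {D} {c} {d} ld const n = begin
  segment d (∇ F) D (suc n)              ≡⟨ sym (⊛-segment d {∇ F} D (suc n) tail-zero) ⟩
  (∇ F ⊛ D) (d + suc n)                  ≡⟨ sym (∇-⊛ F D (d + suc n)) ⟩
  ∇ (F ⊛ D) (d + suc n)                  ≡⟨ cong (∇ (F ⊛ D)) (ℕ.+-suc d n) ⟩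
  (F ⊛ D) (suc (d + n)) ℤ.- (F ⊛ D) (d + n) ≡⟨ sym (cong₂ ℤ._-_ (ld (suc (d + n))) (ld (d + n))) ⟩
  ϑ F (suc (d + n)) ℤ.- ϑ F (d + n)      ≡⟨ cong₂ (λ x y → + suc (d + n) ℤ.* x ℤ.- + (d + n) ℤ.* y)
                                              (const (suc (d + n)) (ℕ.m≤n⇒m≤1+n (ℕ.m≤m+n d n))) (const (d + n) (ℕ.m≤m+n d n)) ⟩
  + suc (d + n) ℤ.* c ℤ.- + (d + n) ℤ.* c ≡⟨ lem (+ (d + n)) c ⟩
  c ∎
  where
  open ≡-Reasoning
  lem : ∀ x c → (1ℤ ℤ.+ x) ℤ.* c ℤ.- x ℤ.* c ≡ c
  lem = solve-∀
  tail-zero : ∀ k → d < k → ∇ F k ≡ 0ℤ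
  tail-zero (suc k) (s≤s d≤k) = trans (cong₂ ℤ._-_ (const (suc k) (ℕ.m≤n⇒m≤1+n d≤k)) (const k d≤k)) (ℤ.+-inverseʳ c)

-- Finds the degree `d` of the polynomial (1 - z) F. Since `∇ F 0` is `F 0`, the search ends at 0 at
-- the latest.
last-jump : ∀ {F : Series} {c} N → F 0 ≢ 0ℤ → (∀ n → N ≤ n → F n ≡ c) →
            ∃[ d ] (d ≤ N × (∀ n → d ≤ n → F n ≡ c) × ∇ F d ≢ 0ℤ)
last-jump zero F₀ h = 0 , z≤n , h , F₀
last-jump {F} {c} (suc N) F₀ h with F N ℤ.≟ c
... | no F≢ = suc N , ℕ.≤-refl , h ,
  λ eq → F≢ (trans (sym (ℤ.i-j≡0⇒i≡j (F (suc N)) (F N) eq)) (h (suc N) ℕ.≤-refl))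
... | yes F≡ with last-jump {F} {c} N F₀ h′
  where
  h′ : ∀ n → N ≤ n → F n ≡ c
  h′ n N≤n with ℕ.m≤n⇒m<n∨m≡n N≤n
  ... | inj₁ N<n  = h n N<n
  ... | inj₂ refl = F≡
... | d , d≤N , const , jump = d , ℕ.m≤n⇒m≤1+n d≤N , const , jump

-- Divisibility after a gap

slide : ∀ {f : Series} {n} j L → (∀ i → i < j → f (suc i + n) ≡ 0ℤ) → (L ⊛ f) (j + n) ≡ (drop j L ⊛ f) n
slide zero L h = refl
slide {f} {n} (suc j) L h = begin
  L 0 ℤ.* f (suc j + n) ℤ.+ (L ∘ suc ⊛ f) (j + n)
    ≡⟨ cong₂ (λ x y → L 0 ℤ.* x ℤ.+ y) (h j ℕ.≤-refl) (slide j (L ∘ suc) (λ i i<j → h i (ℕ.m<n⇒m<1+n i<j))) ⟩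
  L 0 ℤ.* 0ℤ ℤ.+ (drop (suc j) L ⊛ f) n
    ≡⟨ cong (ℤ._+ (drop (suc j) L ⊛ f) n) (ℤ.*-zeroʳ (L 0)) ⟩
  0ℤ ℤ.+ (drop (suc j) L ⊛ f) n
    ≡⟨ ℤ.+-identityˡ _ ⟩
  (drop (suc j) L ⊛ f) n ∎
  where open ≡-Reasoning

-- Across a gap of length W, the recurrence n f(n) = Σ l(k) f(n - k) at n + W and at n
-- has the same right-hand side.
gap : ∀ M {f l W} → let open Congruence M in
      LogDerivative f l → l 0 ≡ 0ℤ → 0 < W → (∀ n → 0 < n → l (n + W) ≈ l n) →
      ∀ n → (∀ i → i < W → f (i + n) ≡ 0ℤ) → ϑ f (W + n) ≈ 0ℤ
gap M {f} {l} {suc W} ld l₀ _ per n zero-gap = ≈-trans (≈-reflexive ϑ≡)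
  (≈-trans (agree n (zero-gap 0 z<s)) (≈-reflexive ϑ≡0))
  where
  open Congruence M
  l⊛f : ∀ x → (l ⊛ f) x ≡ ϑ f x
  l⊛f x = trans (⊛-comm l f x) (sym (ld x))
  ϑ≡ : ϑ f (suc W + n) ≡ (drop (suc W) l ⊛ f) n
  ϑ≡ = begin
    ϑ f (suc W + n)                                        ≡⟨ sym (l⊛f (suc W + n)) ⟩
    l 0 ℤ.* f (suc W + n) ℤ.+ (l ∘ suc ⊛ f) (W + n)        ≡⟨ cong (λ x → x ℤ.* f (suc W + n) ℤ.+ (l ∘ suc ⊛ f) (W + n)) l₀ ⟩
    0ℤ ℤ.* f (suc W + n) ℤ.+ (l ∘ suc ⊛ f) (W + n)         ≡⟨ cong (ℤ._+ (l ∘ suc ⊛ f) (W + n)) (ℤ.*-zeroˡ (f (suc W + n))) ⟩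
    0ℤ ℤ.+ (l ∘ suc ⊛ f) (W + n)                           ≡⟨ ℤ.+-identityˡ _ ⟩
    (l ∘ suc ⊛ f) (W + n)                                  ≡⟨ slide W (l ∘ suc) (λ i i<W → zero-gap (suc i) (s<s i<W)) ⟩
    (drop (suc W) l ⊛ f) n                                 ∎
    where open ≡-Reasoning
  ϑ≡0 : (l ⊛ f) n ≡ 0ℤ
  ϑ≡0 = trans (l⊛f n) (trans (cong (+ n ℤ.*_) (zero-gap 0 z<s)) (ℤ.*-zeroʳ (+ n)))
  ⊛-≈ : ∀ {g h} n → (∀ k → g k ≈ h k) → (g ⊛ f) n ≈ (h ⊛ f) n
  *-congʳ : ∀ {x y} c → x ≈ y → x ℤ.* c ≈ y ℤ.* c
  *-congʳ {x} {y} c x≈y = subst₂ _≈_ (ℤ.*-comm c x) (ℤ.*-comm c y) (*-congˡ c x≈y)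
  ⊛-≈ zero    h = *-congʳ (f 0) (h 0)
  ⊛-≈ (suc n) h = +-cong (*-congʳ (f (suc n)) (h 0)) (⊛-≈ n (h ∘ suc))
  l-shift : ∀ k → l (suc W + suc k) ≈ l (suc k)
  l-shift k = ≈-trans (≈-reflexive (cong l (ℕ.+-comm (suc W) (suc k)))) (per (suc k) z<s)
  vanish : ∀ x y {z} → z ≡ 0ℤ → x ℤ.* z ≈ y ℤ.* z
  vanish x y refl = ≈-reflexive (trans (ℤ.*-zeroʳ x) (sym (ℤ.*-zeroʳ y)))
  -- The periodicity says nothing about index 0, but there the coefficient of `l` is multiplied by
  -- `f n`, which lies in the gap.
  agree : ∀ n → f n ≡ 0ℤ → (drop (suc W) l ⊛ f) n ≈ (l ⊛ f) n
  agree zero    fn≡0 = vanish (l (suc W + 0)) (l 0) fn≡0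
  agree (suc n) fn≡0 = +-cong (vanish (l (suc W + 0)) (l 0) fn≡0) (⊛-≈ n l-shift)

-- The representation series and its window

product : ∀ {k} → Vector ℕ k → ℕ
product {zero}  b = 1
product {suc k} b = b zero * product (b ∘ suc)

∣-product : ∀ {k} (b : Vector ℕ k) i → b i ∣ product b
∣-product b zero    = m∣m*n (product (b ∘ suc))
∣-product b (suc i) = ∣n⇒∣m*n (b zero) (∣-product (b ∘ suc) i)

product>0 : ∀ {k} (b : Vector ℕ k) → (∀ i → 0 < b i) → 0 < product b
product>0 {zero}  b h = z<s
product>0 {suc k} b h = ℕ.*-mono-≤ (h zero) (product>0 (b ∘ suc) (h ∘ suc))

power-0 : ∀ {f} e → f 0 ≡ 1ℤ → power f e 0 ≡ 1ℤ
power-0 zero    h = refl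
power-0 (suc e) h = cong₂ ℤ._*_ h (power-0 e h)

∏-0 : ∀ {k} {f : Vector Series k} → (∀ i → f i 0 ≡ 1ℤ) → ∏ f 0 ≡ 1ℤ
∏-0 {zero}  h = refl
∏-0 {suc k} h = cong₂ ℤ._*_ (h zero) (∏-0 (h ∘ suc))

representationSeries : ∀ {k} (b e : Vector ℕ k) → Series → Series
representationSeries b e f = ∏ (λ i → power (ψℤ (b i) f) (e i))

module Window {m : ℕ} (b e : Vector ℕ (suc m)) (0<b : ∀ i → 0 < b i) (0<e₀ : 0 < e zero)
  (b₀<b : ∀ i → b zero < b (suc i))
  {p t : ℕ} (pr : Prime p) (p^t∣b₀ : p ^ t ∣ b zero) (p^t∤b : ∀ i → ¬ (p ^ t ∣ b (suc i)))
  (f : Series) (f₀ : f 0 ≡ 1ℤ) {c : ℤ} {N : ℕ}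
  (const : ∀ n → N ≤ n → representationSeries b e f n ≡ c)
  where

  open LogDerivativeExists f renaming (logDerivative to l)

  F : Series
  F = representationSeries b e f

  w : Vector ℤ (suc m)
  w i = + e i ℤ.* + b i

  open Weighted b w 0<b

  logDerivative-F : LogDerivative F (𝓣 l)
  logDerivative-F n = trans
    (logDerivative-∏ (λ i → logDerivative-power (e i) (logDerivative-ψ (b i) (isLogDerivative f₀))) n)
    (⊛-cong {F} (λ _ → refl)
      (λ k → sum-cong-≗ (λ i → sym (ℤ.*-assoc (+ e i) (+ b i) (ψℤ (b i) l k)))) n)

  F₀ : F 0 ≡ 1ℤ
  F₀ = ∏-0 {f = λ i → power (ψℤ (b i) f) (e i)} (λ i → power-0 (e i) (trans (ψ-zero (b i) 0ℤ f) f₀))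

  raise-b : ∀ i k {n x} → p ^ k ∣ n → b (suc i) * x ≡ b zero * n → p ^ suc k ∣ x
  raise-b i k {n} {x} p^k∣n eq = raise pr t k (p^t∤b i)
    (subst₂ _∣_ (trans (ℕ.*-comm (p ^ t) (p ^ k)) (sym (ℕ.^-distribˡ-+-* p k t))) (sym eq)
      (*-pres-∣ p^t∣b₀ p^k∣n))

  jump : ∃[ d ] (d ≤ N × (∀ n → d ≤ n → F n ≡ c) × ∇ F d ≢ 0ℤ)
  jump = last-jump N (λ eq → contradiction (trans (sym F₀) eq) (λ ())) const

  d = proj₁ jump
  B = product b

  -- `e zero * b zero` has to be cancelled to solve for `l n`; the last coefficient `∇ F d` has to
  -- be cancelled to reverse the recurrence.
  obstruction : ℕ
  obstruction = e zero * b zero * ℤ.∣ ∇ F d ∣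

  obstruction>0 : 0 < obstruction
  obstruction>0 = ℕ.*-mono-≤ (ℕ.*-mono-≤ 0<e₀ (0<b zero))
    (ℕ.n≢0⇒n>0 (λ eq → proj₂ (proj₂ (proj₂ jump)) (ℤ.∣i∣≡0⇒i≡0 eq)))

  -- The degree in `M` that results from `τ ≤ M ^ d` and a final period of at most
  -- `τ * (B * (τ ^ B * τ ^ B))`.
  exponent : ℕ
  exponent = d + (d * B + d * B)

  window : ∀ M → 0 < M → Coprime M obstruction →
           ∃[ W ] (0 < W × W ≤ B * M ^ exponent ×
                   (∀ n → (∀ i → i < W → f (i + n) ≡ 0ℤ) → + M ℤ∣.∣ ϑ f (W + n)))
  window M 0<M M⊥ = W , 0<W , W≤ , window-divides
    where
    open Congruence M
    M⊥w₀ : Coprime M ℤ.∣ w zero ∣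
    M⊥w₀ = subst (Coprime M) (sym (ℤ.abs-* (+ e zero) (+ b zero))) (coprime-∣ (m∣m*n ℤ.∣ ∇ F d ∣) M⊥)
    open Recurrence M {{>-nonZero 0<M}} {d} {∇ F} {𝓣 l} {c} F₀ (coprime-∣ (n∣m*n (e zero * b zero)) M⊥)
      (segment-logDerivative {F} {𝓣 l} {c} {d} logDerivative-F (proj₁ (proj₂ (proj₂ jump))))
    open Periodicity b w 0<b pr b₀<b raise-b M M⊥w₀ (product>0 b 0<b) (∣-product b) using (periodic)
    τ-data = recurrence-periodic
    τ = proj₁ τ-data
    τ≤ : τ ≤ M ^ d
    τ≤ = proj₁ (proj₂ (proj₂ τ-data))
    W-data = periodic {l} {τ} (proj₁ (proj₂ τ-data)) (proj₂ (proj₂ (proj₂ τ-data)))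
    W = proj₁ W-data
    0<W = proj₁ (proj₂ W-data)
    W≤ : W ≤ B * M ^ exponent
    W≤ = begin
      W                                              ≤⟨ proj₁ (proj₂ (proj₂ W-data)) ⟩
      τ * (B * (τ ^ B * τ ^ B))                      ≤⟨ ℕ.*-mono-≤ τ≤ (ℕ.*-monoʳ-≤ B (ℕ.*-mono-≤ (ℕ.^-monoˡ-≤ B τ≤) (ℕ.^-monoˡ-≤ B τ≤))) ⟩
      M ^ d * (B * ((M ^ d) ^ B * (M ^ d) ^ B))      ≡⟨ cong (λ x → M ^ d * (B * (x * x))) (ℕ.^-*-assoc M d B) ⟩
      M ^ d * (B * (M ^ (d * B) * M ^ (d * B)))      ≡⟨ cong (λ x → M ^ d * (B * x)) (sym (ℕ.^-distribˡ-+-* M (d * B) (d * B))) ⟩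
      M ^ d * (B * M ^ (d * B + d * B))              ≡⟨ lem (M ^ d) B (M ^ (d * B + d * B)) ⟩
      B * (M ^ d * M ^ (d * B + d * B))              ≡⟨ cong (B *_) (sym (ℕ.^-distribˡ-+-* M d (d * B + d * B))) ⟩
      B * M ^ exponent                               ∎
      where
      open ℕ.≤-Reasoning
      lem : ∀ x y z → x * (y * z) ≡ y * (x * z)
      lem = ℕSolver.solve-∀
    window-divides : ∀ n → (∀ i → i < W → f (i + n) ≡ 0ℤ) → + M ℤ∣.∣ ϑ f (W + n)
    window-divides n zeros = subst (+ M ℤ∣.∣_) (ℤ.+-identityʳ (ϑ f (W + n)))
      (M∣x-y (gap M {f} {l} {W} (isLogDerivative f₀) refl 0<W (proj₂ (proj₂ (proj₂ W-data))) n zeros))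

-- Gaps

coprime-*-∣ : ∀ {m n k} → Coprime m n → m ∣ k → n ∣ k → m * n ∣ k
coprime-*-∣ {m} {n} m⊥n m∣k (divides q refl) =
  *-monoˡ-∣ n (coprime-divisor m⊥n (subst (m ∣_) (ℕ.*-comm q n) m∣k))

n∣n! : ∀ n → 0 < n → n ∣ n !
n∣n! (suc n) _ = m∣m*n (n !)

-- The moduli 1 + i y of Gödel's β-function.
module Moduli (y : ℕ) where

  modulus : ℕ → ℕ
  modulus i = 1 + i * y

  moduli-product : ℕ → ℕ
  moduli-product zero    = 1
  moduli-product (suc r) = modulus (suc r) * moduli-product r

  modulus-coprime : ∀ i → Coprime (modulus i) y
  modulus-coprime i {d} (d∣m , d∣y) = ∣1⇒≡1 (∣m+n∣m⇒∣n (subst (d ∣_) (ℕ.+-comm 1 (i * y)) d∣m) (∣n⇒∣m*n i d∣y))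

  module _ {r : ℕ} (r!∣y : r ! ∣ y) where

    -- A common divisor divides `(i ∸ j) * y` and is prime to `y`, so it divides `i ∸ j`, hence
    -- `r !`, hence `y` after all.
    moduli-coprime : ∀ i j → j < i → i ≤ r → Coprime (modulus i) (modulus j)
    moduli-coprime i j j<i i≤r {d} (d∣mi , d∣mj) = modulus-coprime i (d∣mi , d∣y)
      where
      k = i ∸ j
      i≡ : j + k ≡ i
      i≡ = ℕ.m+[n∸m]≡n (ℕ.<⇒≤ j<i)
      lem : ∀ j k y → 1 + (j + k) * y ≡ 1 + j * y + y * k
      lem = ℕSolver.solve-∀
      d∣yk : d ∣ y * k
      d∣yk = ∣m+n∣m⇒∣n (subst (d ∣_) (trans (cong modulus (sym i≡)) (lem j k y)) d∣mi) d∣mj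
      d⊥y : Coprime d y
      d⊥y (e∣d , e∣y) = modulus-coprime i (∣-trans e∣d d∣mi , e∣y)
      k≤r : k ≤ r
      k≤r = ℕ.≤-trans (ℕ.m∸n≤m i j) i≤r
      d∣y : d ∣ y
      d∣y = ∣-trans (coprime-divisor d⊥y d∣yk)
        (∣-trans (n∣n! k (ℕ.m<n⇒0<n∸m j<i)) (∣-trans (m≤n⇒m!∣n! k≤r) r!∣y))

    modulus-coprime-product : ∀ i j → j < i → i ≤ r → Coprime (modulus i) (moduli-product j)
    modulus-coprime-product i zero    j<i i≤r (_ , d∣1) = ∣1⇒≡1 d∣1
    modulus-coprime-product i (suc j) j<i i≤r =
      coprime-* (moduli-coprime i (suc j) j<i i≤r) (modulus-coprime-product i j (ℕ.<⇒≤ j<i) i≤r)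

    moduli-product-∣ : ∀ {n} j → j ≤ r → (∀ i → i ≤ r → modulus i ∣ n) → moduli-product j ∣ n
    moduli-product-∣ {n} zero    _   h = 1∣ n
    moduli-product-∣ (suc j) j<r h = coprime-*-∣ (modulus-coprime-product (suc j) j ℕ.≤-refl j<r)
      (h (suc j) j<r) (moduli-product-∣ j (ℕ.<⇒≤ j<r) h)

  y^r≤moduli-product : ∀ r → y ^ r ≤ moduli-product r
  y^r≤moduli-product zero    = ℕ.≤-refl
  y^r≤moduli-product (suc r) = ℕ.*-mono-≤ (ℕ.m≤n⇒m≤1+n (ℕ.m≤m+n y (r * y))) (y^r≤moduli-product r)

  modulus-≤ : 0 < y → ∀ {i r} → i ≤ r → modulus i ≤ (1 + r) * y
  modulus-≤ 0<y i≤r = ℕ.+-mono-≤ 0<y (ℕ.*-monoˡ-≤ y i≤r)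

-- Below a product of many coprime moduli all additive gaps are small compared with that product,
-- which gives more ones than few allows.
module Sparse (f : Series) (f₀ : f 0 ≡ 1ℤ) (binary : ∀ n → f n ≡ 0ℤ ⊎ f n ≡ 1ℤ)
  {Z K C : ℕ} (0<Z : 0 < Z) (0<K : 0 < K)
  (window : ∀ M → 0 < M → Coprime M Z →
            ∃[ W ] (0 < W × W ≤ K * M ^ C ×
                    (∀ n → (∀ i → i < W → f (i + n) ≡ 0ℤ) → + M ℤ∣.∣ ϑ f (W + n))))
  {h C₁ : ℕ}
  (few : ∀ k n (x : Fin k → ℕ) → (∀ i → f (x i) ≡ 1ℤ) → (∀ i → x i ≤ n) →
         (∀ i j → x i ≡ x j → i ≡ j) → k * k ≤ (h * n + 1) * C₁)
  {H N : ℕ}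
  (lacunary : ∀ X → N ≤ X → ∃[ n ] (f n ≡ 1ℤ × n ≤ X × X ≤ H * n))
  where

  module Gaps (y r : ℕ) (0<y : 0 < y) (Z∣y : Z ∣ y) (r!∣y : r ! ∣ y) where
    open Moduli y

    -- `W` bounds the windows of all `r` moduli at once, since each modulus is at most
    -- `(1 + r) * y`.
    Λ W : ℕ
    Λ = moduli-product r
    W = K * ((1 + r) * y) ^ C

    0<W : 0 < W
    0<W = ℕ.*-mono-≤ 0<K (ℕ.m^n>0 ((1 + r) * y) {{ℕ.m*n≢0 (1 + r) y {{_}} {{>-nonZero 0<y}}}} C)

    zeros⇒Λ∣ : ∀ n → f (W + n) ≡ 1ℤ → (∀ i → i < W → f (i + n) ≡ 0ℤ) → Λ ∣ W + n
    zeros⇒Λ∣ n one zeros = moduli-product-∣ {r} r!∣y r ℕ.≤-refl divides-each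
      where
      divides-each : ∀ i → i ≤ r → modulus i ∣ W + n
      divides-each i i≤r with window (modulus i) z<s (coprime-∣ Z∣y (modulus-coprime i))
      -- The window `V` of one modulus may be shorter than `W`; only the last `V` zeros of the gap
      -- are used, whence the start `W ∸ V + n`.
      ... | V , 0<V , V≤ , div = subst (modulus i ∣_) abs≡ (ℤ∣.∣⇒∣ᵤ (div (W ∸ V + n) zeros′))
        where
        V≤W : V ≤ W
        V≤W = ℕ.≤-trans V≤ (ℕ.*-monoʳ-≤ K (ℕ.^-monoˡ-≤ C (modulus-≤ 0<y i≤r)))
        split : V + (W ∸ V + n) ≡ W + n
        split = trans (sym (ℕ.+-assoc V (W ∸ V) n)) (cong (_+ n) (ℕ.m+[n∸m]≡n V≤W))
        zeros′ : ∀ j → j < V → f (j + (W ∸ V + n)) ≡ 0ℤ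
        zeros′ j j<V = trans (cong f (sym (ℕ.+-assoc j (W ∸ V) n)))
          (zeros (j + (W ∸ V)) (subst (j + (W ∸ V) <_) (ℕ.m+[n∸m]≡n V≤W) (ℕ.+-monoˡ-< (W ∸ V) j<V)))
        abs≡ : ℤ.∣ ϑ f (V + (W ∸ V + n)) ∣ ≡ W + n
        abs≡ = cong ℤ.∣_∣ (trans (cong (ϑ f) split) (trans (cong (+ (W + n) ℤ.*_) one) (ℤ.*-identityʳ (+ (W + n)))))

    -- Were the `W` places below `n` all empty, `Λ` would divide `n`, which is positive and less
    -- than `Λ`.
    previous : ∀ n → 0 < n → n < Λ → f n ≡ 1ℤ → ∃[ x ] (f x ≡ 1ℤ × x < n × n ≤ x + W)
    previous n 0<n n<Λ fn with ℕ.≤-total n W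
    -- Too close to 0 for a full gap below `n`, but the normalisation `f 0 ≡ 1ℤ` supplies an
    -- element.
    ... | inj₁ n≤W = 0 , f₀ , 0<n , n≤W
    ... | inj₂ W≤n with ℕ.anyUpTo? (λ i → f (i + (n ∸ W)) ℤ.≟ 1ℤ) W
    ... | yes (i , i<W , one) = i + (n ∸ W) , one ,
          subst (i + (n ∸ W) <_) (ℕ.m+[n∸m]≡n W≤n) (ℕ.+-monoˡ-< (n ∸ W) i<W) ,
          ℕ.≤-trans (ℕ.≤-reflexive (sym (ℕ.m∸n+n≡m W≤n))) (ℕ.+-monoˡ-≤ W (ℕ.m≤n+m (n ∸ W) i))
    ... | no none = contradiction n<Λ (ℕ.≤⇒≯ (∣⇒≤ {{>-nonZero 0<n}}
          (subst (Λ ∣_) (ℕ.m+[n∸m]≡n W≤n) (zeros⇒Λ∣ (n ∸ W) (trans (cong f (ℕ.m+[n∸m]≡n W≤n)) fn) zeros))))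
      where
      zeros : ∀ i → i < W → f (i + (n ∸ W)) ≡ 0ℤ
      zeros i i<W with binary (i + (n ∸ W))
      ... | inj₁ ≡0 = ≡0
      ... | inj₂ ≡1 = contradiction (i , i<W , ≡1) none

    -- Going down from `n` in steps of at most `W` cannot jump over an interval of length `W`.
    nearby : ∀ t n → t ≤ n → n < Λ → f n ≡ 1ℤ → ∃[ x ] (f x ≡ 1ℤ × t ≤ x × x ≤ n × x < t + W)
    nearby t = <-rec _ go
      where
      go : ∀ n → (∀ {n′} → n′ < n → t ≤ n′ → n′ < Λ → f n′ ≡ 1ℤ →
                  ∃[ x ] (f x ≡ 1ℤ × t ≤ x × x ≤ n′ × x < t + W)) →
           t ≤ n → n < Λ → f n ≡ 1ℤ → ∃[ x ] (f x ≡ 1ℤ × t ≤ x × x ≤ n × x < t + W)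
      go n rec t≤n n<Λ fn with n ℕ.<? t + W
      ... | yes n<t+W = n , fn , t≤n , ℕ.≤-refl , n<t+W
      ... | no n≮ with previous n (ℕ.≤-trans 0<W (ℕ.≤-trans (ℕ.m≤n+m W t) (ℕ.≮⇒≥ n≮))) n<Λ fn
      ... | n′ , fn′ , n′<n , n≤n′+W
        with rec n′<n (ℕ.+-cancelʳ-≤ W t n′ (ℕ.≤-trans (ℕ.≮⇒≥ n≮) n≤n′+W)) (ℕ.<-trans n′<n n<Λ) fn′
      ... | x , fx , t≤x , x≤n′ , x< = x , fx , t≤x , ℕ.≤-trans x≤n′ (ℕ.<⇒≤ n′<n) , x<

    -- One element is picked in each of the `k` blocks of length `W` that start at or below `n`.
    -- Then `few` bounds `k * k` by a constant times `k * W`, and cancelling `k` bounds `k`, hence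
    -- `n`.
    upper : ∀ n → n < Λ → f n ≡ 1ℤ → n ≤ (h + 1) * C₁ * (W * W)
    upper n n<Λ fn = begin
      n                                  ≡⟨ m≡m%n+[m/n]*n n W {{>-nonZero 0<W}} ⟩
      n % W + quot * W                   ≤⟨ ℕ.+-monoˡ-≤ (quot * W) (ℕ.<⇒≤ (m%n<n n W {{>-nonZero 0<W}})) ⟩
      k * W                              ≤⟨ ℕ.*-monoˡ-≤ W k≤ ⟩
      (h + 1) * C₁ * W * W               ≡⟨ ℕ.*-assoc ((h + 1) * C₁) W W ⟩
      (h + 1) * C₁ * (W * W)             ∎
      where
      open ℕ.≤-Reasoning
      instance
        W≢0 : NonZero W
        W≢0 = >-nonZero 0<W
      quot k : ℕ
      quot = n / W
      k = suc quot
      bounds : ∀ (i : Fin k) → toℕ i * W ≤ n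
      bounds i = ℕ.≤-trans (ℕ.*-monoˡ-≤ W (Fin.toℕ≤pred[n] i)) (m/n*n≤m n W)
      pick : ∀ (i : Fin k) → ∃[ x ] (f x ≡ 1ℤ × toℕ i * W ≤ x × x ≤ n × x < toℕ i * W + W)
      pick i = nearby (toℕ i * W) n (bounds i) n<Λ fn
      x : Fin k → ℕ
      x i = proj₁ (pick i)
      separate : ∀ i j → toℕ i < toℕ j → x i ≢ x j
      separate i j i<j eq = ℕ.<-irrefl eq (ℕ.<-≤-trans (proj₂ (proj₂ (proj₂ (proj₂ (pick i)))))
        (ℕ.≤-trans (ℕ.≤-trans (ℕ.≤-reflexive (ℕ.+-comm (toℕ i * W) W)) (ℕ.*-monoˡ-≤ W i<j)) (proj₁ (proj₂ (proj₂ (pick j))))))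
      x-injective : ∀ i j → x i ≡ x j → i ≡ j
      x-injective i j eq with ℕ.<-cmp (toℕ i) (toℕ j)
      ... | tri< i<j _ _ = contradiction eq (separate i j i<j)
      ... | tri≈ _ i≡j _ = Fin.toℕ-injective i≡j
      ... | tri> _ _ j<i = contradiction (sym eq) (separate j i j<i)
      n≤kW : n ≤ k * W
      n≤kW = begin
        n                 ≡⟨ m≡m%n+[m/n]*n n W ⟩
        n % W + quot * W  ≤⟨ ℕ.+-monoˡ-≤ (quot * W) (ℕ.<⇒≤ (m%n<n n W)) ⟩
        k * W             ∎
      lem : ∀ h k W C → (h * (k * W) + k * W) * C ≡ k * ((h + 1) * C * W)
      lem = ℕSolver.solve-∀
      k≤ : k ≤ (h + 1) * C₁ * W
      k≤ = ℕ.*-cancelˡ-≤ k (begin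
        k * k                             ≤⟨ few k n x (λ i → proj₁ (proj₂ (pick i))) (λ i → proj₁ (proj₂ (proj₂ (proj₂ (pick i))))) x-injective ⟩
        (h * n + 1) * C₁                  ≤⟨ ℕ.*-monoˡ-≤ C₁ (ℕ.+-mono-≤ (ℕ.*-monoʳ-≤ h n≤kW) (ℕ.*-mono-≤ {1} {k} z<s 0<W)) ⟩
        (h * (k * W) + k * W) * C₁        ≡⟨ lem h k W C₁ ⟩
        k * ((h + 1) * C₁ * W)            ∎)

  -- `r` exceeds by one the degree `C + C` of `W * W` in `y`. `C₂` is the factor in
  -- `Λ ≤ C₂ * (W * W)`, and `C₃` is what remains once the powers of `y` are split off. `C₄` makes
  -- `y` exceed `C₃` for the contradiction and `N` for `lacunary`; the factors `Z` and `r !` serve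
  -- the coprimality conditions.
  r C₂ C₃ C₄ y : ℕ
  r = 1 + (C + C)
  C₂ = 1 + H * ((h + 1) * C₁)
  C₃ = C₂ * (K * K) * ((1 + r) ^ C * (1 + r) ^ C)
  C₄ = suc (C₃ + N)
  y = C₄ * (Z * r !)

  0<Zr! : 0 < Z * r !
  0<Zr! = ℕ.*-mono-≤ 0<Z (>-nonZero⁻¹ (r !) {{r ℕ.!≢0}})

  C₄≤y : C₄ ≤ y
  C₄≤y = ℕ.m≤m*n C₄ (Z * r !) {{>-nonZero 0<Zr!}}

  0<y : 0 < y
  0<y = ℕ.≤-trans z<s C₄≤y

  open Gaps y r 0<y (∣n⇒∣m*n C₄ (m∣m*n (r !))) (∣n⇒∣m*n C₄ (n∣m*n Z))
  open Moduli y using (y^r≤moduli-product)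

  C₃<y : C₃ < y
  C₃<y = ℕ.≤-trans (s≤s (ℕ.m≤m+n C₃ N)) C₄≤y

  W²≡ : C₂ * (W * W) ≡ C₃ * (y ^ C * y ^ C)
  W²≡ = trans (cong (λ x → C₂ * (K * x * (K * x))) (^-distribʳ-* C (1 + r) y)) (lem C₂ K ((1 + r) ^ C) (y ^ C))
    where
    lem : ∀ c k x y → c * (k * (x * y) * (k * (x * y))) ≡ c * (k * k) * (x * x) * (y * y)
    lem = ℕSolver.solve-∀

  -- Just below `Λ`, `lacunary` yields an element of size comparable to `Λ`, and `upper` bounds that
  -- element.
  Λ≤ : ∀ X → Λ ≡ suc X → Λ ≤ C₂ * (W * W)
  Λ≤ X Λ≡ with lacunary X (s≤s⁻¹ (subst (N <_) Λ≡ (begin-strict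
      N               <⟨ s≤s (ℕ.m≤n+m N C₃) ⟩
      C₄              ≤⟨ C₄≤y ⟩
      y               ≤⟨ ℕ.m≤m*n y (y ^ (C + C)) {{ℕ.m^n≢0 y (C + C) {{>-nonZero 0<y}}}} ⟩
      y ^ r           ≤⟨ y^r≤moduli-product r ⟩
      Λ               ∎)))
    where open ℕ.≤-Reasoning
  ... | n , fn , n≤X , X≤Hn = begin
    Λ                                              ≡⟨ Λ≡ ⟩
    suc X                                          ≤⟨ s≤s X≤Hn ⟩
    1 + H * n                                      ≤⟨ ℕ.+-mono-≤ (ℕ.*-mono-≤ 0<W 0<W) (ℕ.*-monoʳ-≤ H (upper n (subst (n <_) (sym Λ≡) (s≤s n≤X)) fn)) ⟩
    W * W + H * ((h + 1) * C₁ * (W * W))           ≡⟨ lem (W * W) H ((h + 1) * C₁) ⟩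
    C₂ * (W * W)                                   ∎
    where
    open ℕ.≤-Reasoning
    lem : ∀ x H c → x + H * (c * x) ≡ (1 + H * c) * x
    lem = ℕSolver.solve-∀

  impossible : ⊥
  impossible with Λ in Λ≡
  ... | zero  = contradiction (subst (y ^ r ≤_) Λ≡ (y^r≤moduli-product r)) (ℕ.<⇒≱ (ℕ.m^n>0 y {{>-nonZero 0<y}} r))
  ... | suc X = ℕ.<⇒≱ C₃<y (ℕ.*-cancelʳ-≤ y C₃ (y ^ C * y ^ C)
    {{ℕ.m*n≢0 (y ^ C) (y ^ C) {{ℕ.m^n≢0 y C {{>-nonZero 0<y}}}} {{ℕ.m^n≢0 y C {{>-nonZero 0<y}}}}}} (begin
      y * (y ^ C * y ^ C)       ≡⟨ cong (y *_) (sym (ℕ.^-distribˡ-+-* y C C)) ⟩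
      y ^ r                     ≤⟨ y^r≤moduli-product r ⟩
      Λ                         ≤⟨ Λ≤ X Λ≡ ⟩
      C₂ * (W * W)              ≡⟨ W²≡ ⟩
      C₃ * (y ^ C * y ^ C)      ∎))
    where open ℕ.≤-Reasoning

-- Counting representations

Counts : Set
Counts = ℕ → ℕ

infixl 7 _⊛ℕ_
_⊛ℕ_ : Counts → Counts → Counts
(F ⊛ℕ G) zero    = F 0 * G 0
(F ⊛ℕ G) (suc n) = F 0 * G (suc n) + (F ∘ suc ⊛ℕ G) n

oneℕ : Counts
oneℕ zero    = 1
oneℕ (suc _) = 0

powerℕ : Counts → ℕ → Counts
powerℕ F zero    = oneℕ
powerℕ F (suc e) = F ⊛ℕ powerℕ F e

∏ℕ : ∀ {k} → Vector Counts k → Counts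
∏ℕ {zero}  F = oneℕ
∏ℕ {suc k} F = F zero ⊛ℕ ∏ℕ (F ∘ suc)

pos-⊛ : ∀ F G n → + (F ⊛ℕ G) n ≡ ((+_ ∘ F) ⊛ (+_ ∘ G)) n
pos-⊛ F G zero    = ℤ.pos-* (F 0) (G 0)
pos-⊛ F G (suc n) = trans (ℤ.pos-+ (F 0 * G (suc n)) _)
  (cong₂ ℤ._+_ (ℤ.pos-* (F 0) (G (suc n))) (pos-⊛ (F ∘ suc) G n))

pos-one : ∀ n → + oneℕ n ≡ one n
pos-one zero    = refl
pos-one (suc n) = refl

pos-power : ∀ {F f} e → (∀ n → + F n ≡ f n) → ∀ n → + powerℕ F e n ≡ power f e n
pos-power zero    h n = pos-one n
pos-power {F} (suc e) h n = trans (pos-⊛ F (powerℕ F e) n) (⊛-cong h (pos-power e h) n)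

pos-∏ : ∀ {k} {F : Vector Counts k} {f : Vector Series k} → (∀ i n → + F i n ≡ f i n) →
        ∀ n → + ∏ℕ F n ≡ ∏ f n
pos-∏ {zero}  h n = pos-one n
pos-∏ {suc k} {F} h n = trans (pos-⊛ (F zero) (∏ℕ (F ∘ suc)) n) (⊛-cong (h zero) (pos-∏ (h ∘ suc)) n)

pos-ψ : ∀ b F n → + ψ 0 b F n ≡ ψℤ b (+_ ∘ F) n
pos-ψ b F n with b ∣? n
... | yes (divides q _) = refl
... | no _              = refl

representationCounts : ∀ {k} (b e : Vector ℕ k) → Counts → Counts
representationCounts b e α = ∏ℕ (λ i → powerℕ (ψ 0 (b i) α) (e i))

pos-representation : ∀ {k} (b e : Vector ℕ k) α n →
                     + representationCounts b e α n ≡ representationSeries b e (+_ ∘ α) n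
pos-representation b e α = pos-∏ (λ i → pos-power (e i) (pos-ψ (b i) α))

Pieces : Counts → Counts → ℕ → Set
Pieces F G n = Σ[ k ∈ ℕ ] Σ[ l ∈ ℕ ] (k + l ≡ n × Fin (F k) × Fin (G l))

split : ∀ F G n → Fin ((F ⊛ℕ G) n) → Pieces F G n
split F G zero x with remQuot (G 0) x
... | i , j = 0 , 0 , refl , i , j
split F G (suc n) x with splitAt (F 0 * G (suc n)) x
... | inj₁ y = 0 , suc n , refl , remQuot (G (suc n)) y
... | inj₂ y with split (F ∘ suc) G n y
...   | k , l , eq , ij = suc k , l , cong suc eq , ij

merge : ∀ F G n → Pieces F G n → Fin ((F ⊛ℕ G) n)
merge F G zero    (zero , zero , _ , i , j)     = combine i j
merge F G (suc n) (zero , .(suc n) , refl , i , j) = combine i j ↑ˡ (F ∘ suc ⊛ℕ G) n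
merge F G (suc n) (suc k , l , eq , ij)         =
  (F 0 * G (suc n)) ↑ʳ merge (F ∘ suc) G n (k , l , ℕ.suc-injective eq , ij)

merge-split : ∀ F G n x → merge F G n (split F G n x) ≡ x
merge-split F G zero x = Fin.combine-remQuot {F 0} (G 0) x
merge-split F G (suc n) x with splitAt (F 0 * G (suc n)) x in eq
... | inj₁ y = trans (cong (_↑ˡ (F ∘ suc ⊛ℕ G) n) (Fin.combine-remQuot {F 0} (G (suc n)) y))
                     (Fin.splitAt⁻¹-↑ˡ eq)
... | inj₂ y = trans (cong ((F 0 * G (suc n)) ↑ʳ_)
    (trans (irrelevant (split (F ∘ suc) G n y)) (merge-split (F ∘ suc) G n y)))
  (Fin.splitAt⁻¹-↑ʳ eq)
  where
  irrelevant : ∀ s → merge (F ∘ suc) G n (proj₁ s , proj₁ (proj₂ s) , ℕ.suc-injective (cong suc (proj₁ (proj₂ (proj₂ s)))) , proj₂ (proj₂ (proj₂ s))) ≡ merge (F ∘ suc) G n s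
  irrelevant (k , l , e , ij) = cong (λ e → merge (F ∘ suc) G n (k , l , e , ij)) (ℕ.≡-irrelevant _ e)

split-merge : ∀ F G n xs → split F G n (merge F G n xs) ≡ xs
split-merge F G zero (zero , zero , refl , i , j) rewrite Fin.remQuot-combine {F 0} {G 0} i j = refl
split-merge F G (suc n) (zero , .(suc n) , refl , i , j)
  rewrite Fin.splitAt-↑ˡ (F 0 * G (suc n)) (combine i j) ((F ∘ suc ⊛ℕ G) n)
        | Fin.remQuot-combine {F 0} {G (suc n)} i j = refl
split-merge F G (suc n) (suc k , l , eq , ij)
  rewrite Fin.splitAt-↑ʳ (F 0 * G (suc n)) ((F ∘ suc ⊛ℕ G) n) (merge (F ∘ suc) G n (k , l , ℕ.suc-injective eq , ij))
        | split-merge (F ∘ suc) G n (k , l , ℕ.suc-injective eq , ij)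
  = cong (λ e → suc k , l , e , ij) (ℕ.≡-irrelevant _ _)

∑-cong : ∀ k {f g : Vector ℕ k} → f ≗ g → ∑ k f ≡ ∑ k g
∑-cong zero    p = refl
∑-cong (suc k) p = cong₂ _+_ (p zero) (∑-cong k (p ∘ suc))

-- Expresses that `F n` counts the good elements of weight `n` up to `_~_`. The relation is explicit
-- because the elements will be functions, compared pointwise.
record Enumeration {X : Set} (_~_ : X → X → Set) (Good : X → Set ℓ) (weight : X → ℕ) (F : Counts) : Set ℓ where
  field
    element   : ∀ n → Fin (F n) → X
    good      : ∀ n i → Good (element n i)
    weighs    : ∀ n i → weight (element n i) ≡ n
    injective : ∀ n i j → element n i ~ element n j → i ≡ j
    index     : ∀ n x → Good x → weight x ≡ n → ∃[ i ] (element n i ~ x)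

open Enumeration

unit : {X : Set} {_~_ : X → X → Set} {Good : X → Set ℓ} {weight : X → ℕ} (x : X) →
       (∀ y → x ~ y) → Good x → (∀ y → weight y ≡ 0) → Enumeration _~_ Good weight oneℕ
unit x x~ good-x w .element   zero    zero      = x
unit x x~ good-x w .good      zero    zero      = good-x
unit x x~ good-x w .weighs    zero    zero      = w x
unit x x~ good-x w .injective zero    zero zero _ = refl
unit x x~ good-x w .index     zero    y _ _     = zero , x~ y
unit x x~ good-x w .index     (suc n) y _ wy    = contradiction (trans (sym (w y)) wy) (λ ())

module _ {X Y : Set} {_~_ : X → X → Set} {_~′_ : Y → Y → Set}
  {Good : X → Set ℓ} {Good′ : Y → Set ℓ} {v : X → ℕ} {w : Y → ℕ} {F G : Counts}
  (v-cong : ∀ {x y} → x ~ y → v x ≡ v y) (w-cong : ∀ {x y} → x ~′ y → w x ≡ w y)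
  (E : Enumeration _~_ Good v F) (E′ : Enumeration _~′_ Good′ w G) where

  _≋_ : X × Y → X × Y → Set
  (x , y) ≋ (x′ , y′) = x ~ x′ × y ~′ y′

  pieces : ∀ {n} → Pieces F G n → X × Y
  pieces (k , l , _ , i , j) = element E k i , element E′ l j

  -- Equivalent components have equal weights, so both splittings of `n` agree before the indices
  -- are compared.
  pieces-injective : ∀ {n} (s t : Pieces F G n) → pieces s ≋ pieces t → s ≡ t
  pieces-injective (k , l , refl , i , j) (k′ , l′ , eq , i′ , j′) (p , q)
    with trans (sym (weighs E k i)) (trans (v-cong p) (weighs E k′ i′))
       | trans (sym (weighs E′ l j)) (trans (w-cong q) (weighs E′ l′ j′))
  ... | refl | refl with injective E k i i′ p | injective E′ l j j′ q | eq
  ... | refl | refl | refl = refl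

  pair : Enumeration _≋_ (λ (x , y) → Good x × Good′ y) (λ (x , y) → v x + w y) (F ⊛ℕ G)
  pair .element n s = pieces (split F G n s)
  pair .good n s with split F G n s
  ... | k , l , _ , i , j = good E k i , good E′ l j
  pair .weighs n s with split F G n s
  ... | k , l , eq , i , j = trans (cong₂ _+_ (weighs E k i) (weighs E′ l j)) eq
  pair .injective n s t p = trans (sym (merge-split F G n s))
    (trans (cong (merge F G n) (pieces-injective (split F G n s) (split F G n t) p)) (merge-split F G n t))
  pair .index n (x , y) (gx , gy) eq with index E (v x) x gx refl | index E′ (w y) y gy refl
  ... | i , p | j , q = merge F G n s , subst (λ t → pieces t ≋ (x , y)) (sym (split-merge F G n s)) (p , q)
    where
    s : Pieces F G n
    s = v x , w y , eq , i , j

module _ {X Y : Set} {_~_ : X → X → Set} {_~′_ : Y → Y → Set}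
  {Good : X → Set ℓ} {Good′ : Y → Set ℓ} {v : X → ℕ} {w : Y → ℕ} {F : Counts}
  (to : X → Y) (from : Y → X)
  (to-good : ∀ {x} → Good x → Good′ (to x)) (from-good : ∀ {y} → Good′ y → Good (from y))
  (to-weight : ∀ x → w (to x) ≡ v x) (from-weight : ∀ y → v (from y) ≡ w y)
  (to-injective : ∀ {x y} → to x ~′ to y → x ~ y)
  (to-from : ∀ {x y} → x ~ from y → to x ~′ y) where

  transport : Enumeration _~_ Good v F → Enumeration _~′_ Good′ w F
  transport E .element n i       = to (element E n i)
  transport E .good n i          = to-good (good E n i)
  transport E .weighs n i        = trans (to-weight (element E n i)) (weighs E n i)
  transport E .injective n i j p = injective E n i j (to-injective p)
  transport E .index n y g eq with index E n (from y) (from-good g) (trans (from-weight y) eq)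
  ... | i , p = i , to-from p

module _ {P : Pred ℕ ℓ} (P? : Decidable P) where

  indicator : Counts
  indicator n with P? n
  ... | yes _ = 1
  ... | no _  = 0

  single : ∀ b .{{_ : NonZero b}} → Enumeration _≡_ P (b *_) (ψ 0 b indicator)
  single b .element n i with b ∣? n
  ... | yes (divides q _) = q
  single b .good n i with b ∣? n
  ... | yes (divides q _) with P? q
  ...   | yes Pq = Pq
  single b .weighs n i with b ∣? n
  ... | yes (divides q eq) = trans (ℕ.*-comm b q) (sym eq)
  single b .injective n i j p with b ∣? n
  ... | yes (divides q _) with P? q
  single b .injective n zero zero p | yes (divides q _) | yes _ = refl
  single b .index n x Px refl with b ∣? b * x
  ... | no ∤ = contradiction (divides x (ℕ.*-comm b x)) ∤
  ... | yes (divides q eq) with ℕ.*-cancelʳ-≡ q x b (trans (sym eq) (ℕ.*-comm b x))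
  ...   | refl with P? q
  ...     | yes _ = zero , refl
  ...     | no ¬Pq = contradiction Px ¬Pq

  block : ∀ b .{{_ : NonZero b}} e →
          Enumeration {X = Fin e → ℕ} _≗_ (λ a → ∀ j → P (a j)) (λ a → b * ∑ e a) (powerℕ (ψ 0 b indicator) e)
  block b zero    = unit (λ ()) (λ _ ()) (λ ()) (λ _ → ℕ.*-zeroʳ b)
  block b (suc e) = transport
    (λ (x , a) → λ { zero → x ; (suc j) → a j })
    (λ a → a zero , a ∘ suc)
    (λ { (Px , Pa) zero → Px ; (Px , Pa) (suc j) → Pa j })
    (λ Pa → Pa zero , Pa ∘ suc)
    (λ (x , a) → ℕ.*-distribˡ-+ b x (∑ e a))
    (λ a → sym (ℕ.*-distribˡ-+ b (a zero) (∑ e (a ∘ suc))))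
    (λ p → p zero , p ∘ suc)
    (λ { (p , q) zero → p ; (p , q) (suc j) → q j })
    (pair (cong (b *_)) (λ p → cong (b *_) (∑-cong e p)) (single b) (block b e))

-- Conclusion

linearForm-cong : ∀ {k} (b e : Vector ℕ k) {a a′ : Tuple e} → (∀ i j → a i j ≡ a′ i j) →
                  linearForm b e a ≡ linearForm b e a′
linearForm-cong {k} b e p = ∑-cong k (λ i → cong (b i *_) (∑-cong (e i) (p i)))

∑-+ : ∀ k (f : Vector ℕ k) x → ∑ k (λ i → f i + x) ≡ ∑ k f + x * ∑ k (λ _ → 1)
∑-+ zero    f x = sym (ℕ.*-zeroʳ x)
∑-+ (suc k) f x = trans (cong (λ y → f zero + x + y) (∑-+ k (f ∘ suc) x)) (lem (f zero) x (∑ k (f ∘ suc)) (∑ k (λ _ → 1)))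
  where
  lem : ∀ a x s t → a + x + (s + x * t) ≡ a + s + x * (1 + t)
  lem = ℕSolver.solve-∀

∑-≤ : ∀ k {f : Vector ℕ k} {x} → (∀ i → f i ≤ x) → ∑ k f ≤ x * ∑ k (λ _ → 1)
∑-≤ zero    h = z≤n
∑-≤ (suc k) {f} {x} h = ℕ.≤-trans (ℕ.+-mono-≤ (h zero) (∑-≤ k (h ∘ suc)))
  (ℕ.≤-reflexive (sym (ℕ.*-suc x (∑ k (λ _ → 1)))))

≤-∑ : ∀ k {f : Vector ℕ k} i → f i ≤ ∑ k f
≤-∑ (suc k) zero    = ℕ.m≤m+n _ _
≤-∑ (suc k) (suc i) = ℕ.≤-trans (≤-∑ k i) (ℕ.m≤n+m _ _)

-- This is Σ bᵢ eᵢ, the amount that the linear form gains when every entry grows by 1.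
totalWeight : ∀ {k} (b e : Vector ℕ k) → ℕ
totalWeight b e = linearForm b e (λ _ _ → 1)

linearForm-+ : ∀ {k} (b e : Vector ℕ k) a x →
               linearForm b e (λ i j → a i j + x) ≡ linearForm b e a + x * totalWeight b e
linearForm-+ {zero}  b e a x = sym (ℕ.*-zeroʳ x)
linearForm-+ {suc k} b e a x = trans
  (cong₂ (λ y z → b zero * y + z) (∑-+ (e zero) (a zero) x) (linearForm-+ (b ∘ suc) (e ∘ suc) (a ∘ suc) x))
  (lem (b zero) (∑ (e zero) (a zero)) x (∑ (e zero) (λ _ → 1)) _ _)
  where
  lem : ∀ b s x t u v → b * (s + x * t) + (u + x * v) ≡ b * s + u + x * (b * t + v)
  lem = ℕSolver.solve-∀

linearForm-≤ : ∀ {k} (b e : Vector ℕ k) {a : Tuple e} {x} → (∀ i j → a i j ≤ x) →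
               linearForm b e a ≤ totalWeight b e * x
linearForm-≤ {zero}  b e h = z≤n
linearForm-≤ {suc k} b e {a} {x} h = ℕ.≤-trans
  (ℕ.+-mono-≤ (ℕ.*-monoʳ-≤ (b zero) (∑-≤ (e zero) (h zero))) (linearForm-≤ (b ∘ suc) (e ∘ suc) (h ∘ suc)))
  (ℕ.≤-reflexive (lem (b zero) x (∑ (e zero) (λ _ → 1)) (totalWeight (b ∘ suc) (e ∘ suc))))
  where
  lem : ∀ b x s t → b * (x * s) + t * x ≡ (b * s + t) * x
  lem = ℕSolver.solve-∀

≤-linearForm : ∀ {k} (b e : Vector ℕ k) {a : Tuple e} i j → 0 < b i → a i j ≤ linearForm b e a
≤-linearForm {k} b e {a} i j 0<bi = ℕ.≤-trans (≤-∑ (e i) j)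
  (ℕ.≤-trans (ℕ.m≤n*m (∑ (e i) (a i)) (b i) {{>-nonZero 0<bi}}) (≤-∑ k {λ i → b i * ∑ (e i) (a i)} i))

_≐_ : ∀ {k} {e : Vector ℕ k} → Tuple e → Tuple e → Set
a ≐ a′ = ∀ i j → a i j ≡ a′ i j

tuples : ∀ {k} {P : Pred ℕ ℓ} (P? : Decidable P) (b e : Vector ℕ k) → (∀ i → 0 < b i) →
         Enumeration {X = Tuple e} _≐_ (λ a → ∀ i j → P (a i j)) (linearForm b e)
                     (representationCounts b e (indicator P?))
tuples {k = zero}  P? b e 0<b = unit (λ ()) (λ _ ()) (λ ()) (λ _ → refl)
tuples {k = suc k} P? b e 0<b = transport
  (λ (x , a) → λ { zero → x ; (suc i) → a i })
  (λ a → a zero , a ∘ suc)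
  (λ { (Px , Pa) zero → Px ; (Px , Pa) (suc i) → Pa i })
  (λ Pa → Pa zero , Pa ∘ suc)
  (λ _ → refl)
  (λ _ → refl)
  (λ p → p zero , p ∘ suc)
  (λ { (p , q) zero → p ; (p , q) (suc i) → q i })
  (pair (λ p → cong (b zero *_) (∑-cong (e zero) p)) (linearForm-cong (b ∘ suc) (e ∘ suc))
    (block P? (b zero) {{>-nonZero (0<b zero)}} (e zero)) (tuples P? (b ∘ suc) (e ∘ suc) (0<b ∘ suc)))

least : {P : Pred ℕ ℓ} → Decidable P → ∀ n → P n → ∃[ a ] (P a × (∀ x → P x → a ≤ x))
least {P = P} P? = <-rec _ go
  where
  go : ∀ n → (∀ {m} → m < n → P m → ∃[ a ] (P a × (∀ x → P x → a ≤ x))) → P n →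
       ∃[ a ] (P a × (∀ x → P x → a ≤ x))
  go n rec Pn with ℕ.anyUpTo? P? n
  ... | yes (m , m<n , Pm) = rec m<n Pm
  ... | no none = n , Pn , λ x Px → ℕ.≮⇒≥ (λ x<n → none (x , x<n , Px))

greatest : {P : Pred ℕ ℓ} → Decidable P → P 0 → ∀ X → ∃[ n ] (P n × n ≤ X × (∀ x → x ≤ X → P x → x ≤ n))
greatest P? P0 zero = 0 , P0 , z≤n , λ x x≤0 _ → x≤0
greatest P? P0 (suc X) with P? (suc X)
... | yes PX = suc X , PX , ℕ.≤-refl , λ x x≤X _ → x≤X
... | no ¬PX with greatest P? P0 X
...   | n , Pn , n≤X , max = n , Pn , ℕ.m≤n⇒m≤1+n n≤X , above
  where
  above : ∀ x → x ≤ suc X → _ → x ≤ n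
  above x x≤ Px with ℕ.m≤n⇒m<n∨m≡n x≤
  ... | inj₁ (s≤s x≤X) = max x x≤X Px
  ... | inj₂ refl      = contradiction Px ¬PX

bounded : ∀ (F : ℕ → ℕ) N → ∃[ C ] (∀ n → n < N → F n ≤ C)
bounded F zero = 0 , λ _ ()
bounded F (suc N) with bounded F N
... | C , h = C ⊔ F N , bound
  where
  bound : ∀ n → n < suc N → F n ≤ C ⊔ F N
  bound n (s≤s n≤N) with ℕ.m≤n⇒m<n∨m≡n n≤N
  ... | inj₁ n<N  = ℕ.≤-trans (h n n<N) (ℕ.m≤m⊔n C (F N))
  ... | inj₂ refl = ℕ.m≤n⊔m C (F N)

module _ {P : Pred ℕ ℓ} (P? : Decidable P) where

  indicator-1 : ∀ {n} → P n → indicator P? n ≡ 1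
  indicator-1 {n} Pn with P? n
  ... | yes _ = refl
  ... | no ¬Pn = contradiction Pn ¬Pn

  indicator-1⁻¹ : ∀ {n} → indicator P? n ≡ 1 → P n
  indicator-1⁻¹ {n} eq with P? n
  ... | yes Pn = Pn

  indicator-binary : ∀ n → + indicator P? n ≡ 0ℤ ⊎ + indicator P? n ≡ 1ℤ
  indicator-binary n with P? n
  ... | yes _ = inj₂ refl
  ... | no _  = inj₁ refl

module Contradiction {m : ℕ} (b e : Vector ℕ (suc (suc m)))
  (0<b : ∀ i → 0 < b i) (b₀<b : ∀ i → b zero < b (suc i)) (0<e : ∀ i → 0 < e i)
  {p t : ℕ} (pr : Prime p) (p^t∣b₀ : p ^ t ∣ b zero) (p^t∤b : ∀ i → p ^ t ∤ b (suc i))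
  (A : Pred ℕ ℓ) (infinite : Infinite A)
  {c n₀ : ℕ} (r≡c : ∀ n → n₀ < n → r[ b , e ]⟨ n , A ⟩≡ c)
  where

  H : ℕ
  H = totalWeight b e

  entry : ∀ i → Fin (e i)
  entry i = fromℕ< (0<e i)

  0<H : 0 < H
  0<H = ≤-linearForm b e {λ _ _ → 1} zero (entry zero) (0<b zero)

  module Rep (n : ℕ) (n₀<n : n₀ < n) where

    tuple : Fin c → Tuple e
    tuple i = proj₁ (Inverse.to (r≡c n n₀<n) i)

    tuple-A : ∀ i x y → A (tuple i x y)
    tuple-A i = proj₁ (proj₂ (Inverse.to (r≡c n n₀<n) i))

    tuple-form : ∀ i → n ≡ linearForm b e (tuple i)
    tuple-form i = proj₂ (proj₂ (Inverse.to (r≡c n n₀<n) i))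

    find : (a : Tuple e) → (∀ i j → A (a i j)) → n ≡ linearForm b e a → Fin c
    find a Aa eq = Inverse.from (r≡c n n₀<n) (a , Aa , eq)

    tuple-find : ∀ a Aa eq → tuple (find a Aa eq) ≐ a
    tuple-find a Aa eq = Inverse.strictlyInverseˡ (r≡c n n₀<n) (a , Aa , eq)

    tuple-injective : ∀ i j → tuple i ≐ tuple j → i ≡ j
    tuple-injective i j p = trans (sym (Inverse.strictlyInverseʳ (r≡c n n₀<n) i))
      (trans (Inverse.from-cong (r≡c n n₀<n) p) (Inverse.strictlyInverseʳ (r≡c n n₀<n) j))

  -- An element above `n₀`, repeated in every position, represents a number above `n₀`; with no
  -- representations there, `A` is bounded by `n₀`.
  c≢0 : c ≢ 0
  c≢0 refl = infinite (upTo (suc n₀) , λ a Aa → ∈-upTo⁺ (s≤s (bound a Aa)))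
    where
    bound : ∀ a → A a → a ≤ n₀
    bound a Aa with a ℕ.≤? n₀
    ... | yes a≤n₀ = a≤n₀
    ... | no a≰n₀ with Rep.find n (ℕ.<-≤-trans (ℕ.≰⇒> a≰n₀) (≤-linearForm b e {λ _ _ → a} zero (entry zero) (0<b zero)))
                         (λ _ _ → a) (λ _ _ → Aa) refl
      where n = linearForm b e (λ _ _ → a)
    ...   | ()

  first : Fin c
  first = fromℕ< (ℕ.n≢0⇒n>0 c≢0)

  -- Infinitude is only a negation and yields no witness. A representation of `suc (H * n₀)` does:
  -- entries of size at most `n₀` cannot reach that value, and a finite search finds the larger one.
  large-element : ∃[ x ] (A x × n₀ < x)
  large-element = search
    where
    n = suc (H * n₀)
    n₀<n : n₀ < n
    n₀<n = s≤s (ℕ.m≤n*m n₀ H {{>-nonZero 0<H}})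
    open Rep n n₀<n
    search : ∃[ x ] (A x × n₀ < x)
    search with Fin.any? (λ i → Fin.any? (λ j → n₀ ℕ.<? tuple first i j))
    ... | yes (i , j , n₀<x) = tuple first i j , tuple-A first i j , n₀<x
    ... | no none = contradiction
      (linearForm-≤ b e {tuple first} (λ i j → ℕ.≮⇒≥ (λ n₀<x → none (i , j , n₀<x))))
      (ℕ.<⇒≱ (ℕ.≤-reflexive (tuple-form first)))

  -- As there are at least two indices `i` and no `e i` is 0, the tuple determines both `x` and `y`.
  two-valued : ℕ → ℕ → Tuple e
  two-valued x y zero    _ = x
  two-valued x y (suc i) _ = y

  two-valued-all : ∀ {ℓ} {P : Pred ℕ ℓ} {x y} → P x → P y → ∀ i j → P (two-valued x y i j)
  two-valued-all Px Py zero    _ = Px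
  two-valued-all Px Py (suc i) _ = Py

  -- a ∈ A iff the tuple with entries a and x₀ is among the c representations of its value; x₀ > n₀
  -- makes that value large enough.
  decide : ∀ {x₀} → A x₀ → n₀ < x₀ → Decidable A
  decide {x₀} Ax₀ n₀<x₀ a = search
    where
    n = linearForm b e (two-valued a x₀)
    n₀<n : n₀ < n
    n₀<n = ℕ.<-≤-trans n₀<x₀
      (≤-linearForm b e {two-valued a x₀} (suc zero) (entry (suc zero)) (0<b (suc zero)))
    open Rep n n₀<n
    search : Dec (A a)
    search with Fin.any? (λ r → Fin.all? (λ i → Fin.all? (λ j → tuple r i j ℕ.≟ two-valued a x₀ i j)))
    ... | yes (r , eq) = yes (subst A (eq zero (entry zero)) (tuple-A r zero (entry zero)))
    ... | no none = no (λ Aa →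
            let good = two-valued-all {P = A} Aa Ax₀ in
            none (find (two-valued a x₀) good refl , tuple-find (two-valued a x₀) good refl))

  module Normalised (A? : Decidable A) {a₀ : ℕ} (Aa₀ : A a₀) (a₀≤ : ∀ x → A x → a₀ ≤ x) where

    P : Pred ℕ _
    P x = A (x + a₀)

    P? : Decidable P
    P? x = A? (x + a₀)

    P0 : P 0
    P0 = Aa₀

    F : Counts
    F = representationCounts b e (indicator P?)

    E = tuples P? b e 0<b

    -- Adding `a₀` to all entries turns representations of `n` by `P` into representations of
    -- `n + a₀ * H` by `A`. Minimality of `a₀` makes this reversible, and the new number is still
    -- above `n₀`.
    F≡c : ∀ n → n₀ < n → F n ≡ c
    F≡c n n₀<n = ℕ.≤-antisym (Fin.injective⇒≤ {f = to} to-injective) (Fin.injective⇒≤ {f = from} from-injective)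
      where
      shifted : ∀ a → linearForm b e (λ i j → a i j + a₀) ≡ linearForm b e a + a₀ * H
      shifted a = linearForm-+ b e a a₀
      open Rep (n + a₀ * H) (ℕ.<-≤-trans n₀<n (ℕ.m≤m+n n (a₀ * H)))
      eq : ∀ i → n + a₀ * H ≡ linearForm b e (λ x y → element E n i x y + a₀)
      eq i = sym (trans (shifted (element E n i)) (cong (_+ a₀ * H) (weighs E n i)))
      to : Fin (F n) → Fin c
      to i = find (λ x y → element E n i x y + a₀) (good E n i) (eq i)
      to-injective : ∀ {i j} → to i ≡ to j → i ≡ j
      to-injective {i} {j} p = injective E n i j (λ x y → ℕ.+-cancelʳ-≡ a₀ _ _
        (trans (sym (tuple-find _ (good E n i) (eq i) x y))
          (trans (cong (λ r → tuple r x y) p) (tuple-find _ (good E n j) (eq j) x y))))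
      lowered : Fin c → Tuple e
      lowered r x y = tuple r x y ∸ a₀
      lowered-+ : ∀ r x y → lowered r x y + a₀ ≡ tuple r x y
      lowered-+ r x y = ℕ.m∸n+n≡m (a₀≤ (tuple r x y) (tuple-A r x y))
      find-lowered : ∀ r → ∃[ i ] (element E n i ≐ lowered r)
      find-lowered r = index E n (lowered r) (λ x y → subst A (sym (lowered-+ r x y)) (tuple-A r x y))
        (ℕ.+-cancelʳ-≡ (a₀ * H) _ _ (trans (sym (shifted (lowered r)))
          (trans (linearForm-cong b e (lowered-+ r)) (sym (tuple-form r)))))
      from : Fin c → Fin (F n)
      from r = proj₁ (find-lowered r)
      from-injective : ∀ {r s} → from r ≡ from s → r ≡ s
      from-injective {r} {s} p = tuple-injective r s (λ x y →
        trans (sym (lowered-+ r x y)) (trans (cong (_+ a₀)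
          (trans (sym (proj₂ (find-lowered r) x y)) (trans (cong (λ i → element E n i x y) p) (proj₂ (find-lowered s) x y))))
          (lowered-+ s x y)))

    f : Series
    f n = + indicator P? n

    f₀ : f 0 ≡ 1ℤ
    f₀ = cong +_ (indicator-1 P? {0} P0)

    constant : ∀ n → suc n₀ ≤ n → representationSeries b e f n ≡ + c
    constant n n₀<n = trans (sym (pos-representation b e (indicator P?) n)) (cong +_ (F≡c n n₀<n))

    open Window b e 0<b (0<e zero) b₀<b {p} {t} pr p^t∣b₀ p^t∤b f f₀ constant using (obstruction; exponent; obstruction>0; window)

    bound = bounded F (suc n₀)
    C₁ = proj₁ bound ⊔ c

    F≤C₁ : ∀ n → F n ≤ C₁
    F≤C₁ n with n ℕ.≤? n₀
    ... | yes n≤n₀ = ℕ.≤-trans (proj₂ bound n (s≤s n≤n₀)) (ℕ.m≤m⊔n _ c)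
    ... | no n≰n₀  = ℕ.≤-trans (ℕ.≤-reflexive (F≡c n (ℕ.≰⇒> n≰n₀))) (ℕ.m≤n⊔m (proj₁ bound) c)

    -- Each of the `k * k` pairs of elements gives its own two-valued tuple. The linear form takes
    -- at most `H * n + 1` values on these tuples, each represented at most `C₁` times.
    few : ∀ k n (x : Fin k → ℕ) → (∀ i → f (x i) ≡ 1ℤ) → (∀ i → x i ≤ n) →
          (∀ i j → x i ≡ x j → i ≡ j) → k * k ≤ (H * n + 1) * C₁
    few k n x fx x≤n x-injective = Fin.injective⇒≤ {f = code ∘ remQuot k} code-injective
      where
      tuple : Fin k × Fin k → Tuple e
      tuple (i , j) = two-valued (x i) (x j)
      weight : Fin k × Fin k → ℕ
      weight ij = linearForm b e (tuple ij)
      find : ∀ ij → ∃[ s ] (element E (weight ij) s ≐ tuple ij)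
      find ij@(i , j) = index E (weight ij) (tuple ij)
        (two-valued-all {P = P} (indicator-1⁻¹ P? (ℤ.+-injective (fx i))) (indicator-1⁻¹ P? (ℤ.+-injective (fx j)))) refl
      weight< : ∀ ij → weight ij < H * n + 1
      weight< ij@(i , j) = subst (weight ij <_) (ℕ.+-comm 1 (H * n))
        (s≤s (linearForm-≤ b e {tuple ij} (two-valued-all {P = _≤ n} (x≤n i) (x≤n j))))
      code : Fin k × Fin k → Fin ((H * n + 1) * C₁)
      code ij = combine (fromℕ< (weight< ij)) (inject≤ (proj₁ (find ij)) (F≤C₁ (weight ij)))
      same-element : ∀ {u v} (s : Fin (F u)) (s′ : Fin (F v)) → u ≡ v → toℕ s ≡ toℕ s′ → element E u s ≐ element E v s′
      same-element s s′ refl eq with Fin.toℕ-injective {i = s} {s′} eq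
      ... | refl = λ _ _ → refl
      tuple-injective : ∀ ij ij′ → tuple ij ≐ tuple ij′ → ij ≡ ij′
      tuple-injective (i , j) (i′ , j′) p = cong₂ _,_
        (x-injective i i′ (p zero (entry zero))) (x-injective j j′ (p (suc zero) (entry (suc zero))))
      code-injective : ∀ {s s′} → code (remQuot k s) ≡ code (remQuot k s′) → s ≡ s′
      code-injective {s} {s′} eq = trans (sym (Fin.combine-remQuot {k} k s))
        (trans (cong (uncurry combine) (tuple-injective ij ij′ same)) (Fin.combine-remQuot {k} k s′))
        where
        ij ij′ : Fin k × Fin k
        ij = remQuot k s
        ij′ = remQuot k s′
        halves = Fin.combine-injective (fromℕ< (weight< ij)) (inject≤ (proj₁ (find ij)) (F≤C₁ (weight ij)))
          (fromℕ< (weight< ij′)) (inject≤ (proj₁ (find ij′)) (F≤C₁ (weight ij′))) eq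
        weight≡ : weight ij ≡ weight ij′
        weight≡ = trans (sym (Fin.toℕ-fromℕ< (weight< ij))) (trans (cong toℕ (proj₁ halves)) (Fin.toℕ-fromℕ< (weight< ij′)))
        index≡ : toℕ (proj₁ (find ij)) ≡ toℕ (proj₁ (find ij′))
        index≡ = trans (sym (Fin.toℕ-inject≤ (proj₁ (find ij)) (F≤C₁ (weight ij))))
          (trans (cong toℕ (proj₂ halves)) (Fin.toℕ-inject≤ (proj₁ (find ij′)) (F≤C₁ (weight ij′))))
        same : tuple ij ≐ tuple ij′
        same i j = trans (sym (proj₂ (find ij) i j))
          (trans (same-element (proj₁ (find ij)) (proj₁ (find ij′)) weight≡ index≡ i j) (proj₂ (find ij′) i j))

    -- Since `c` is not 0, `X` has a representation. Its entries are at most `X`, hence at most the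
    -- greatest element `n` up to `X`, so their weighted sum is at most `H * n`.
    lacunary : ∀ X → suc n₀ ≤ X → ∃[ n ] (f n ≡ 1ℤ × n ≤ X × X ≤ H * n)
    lacunary X n₀<X with greatest P? P0 X
    ... | n , Pn , n≤X , max = n , cong +_ (indicator-1 P? Pn) , n≤X ,
      subst (_≤ H * n) (weighs E X s) (linearForm-≤ b e {element E X s}
        (λ i j → max _ (subst (element E X s i j ≤_) (weighs E X s) (≤-linearForm b e {element E X s} i j (0<b i))) (good E X s i j)))
      where
      s : Fin (F X)
      s = subst Fin (sym (F≡c X n₀<X)) first

    contradictory : ⊥
    contradictory = Sparse.impossible f f₀ (indicator-binary P?) {obstruction} {product b} {exponent} obstruction>0 (product>0 b 0<b) window {H} {C₁} few {H} {suc n₀} lacunary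

  absurd : ⊥
  absurd with large-element
  ... | x₀ , Ax₀ , n₀<x₀ with least (decide Ax₀ n₀<x₀) x₀ Ax₀
  ...   | a₀ , Aa₀ , a₀≤ = Normalised.contradictory (decide Ax₀ n₀<x₀) Aa₀ a₀≤

theorem1p2 :
    ∀ {ℓ : Level} (m : ℕ) → 1 ≤ m →
    (b e : Vector ℕ (suc m)) →
    0 < b zero → (∀ i j → i <ᶠ j → b i < b j) →
    (∀ i → 0 < e i) →
    (∃[ p ] ∃[ t ] (Prime p × 0 < t × (p ^ t) ∣ b zero × (∀ (i : Fin m) → (p ^ t) ∤ b (suc i)))) →
    (A : Pred ℕ ℓ) → (∀ a → A a → 0 < a) → Infinite A →
    ¬ (∃[ c ] ∃[ n₀ ] (∀ n → n₀ < n → r[ b , e ]⟨ n , A ⟩≡ c))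
theorem1p2 (suc m) _ b e 0<b₀ increasing 0<e (p , t , pr , _ , p^t∣b₀ , p^t∤b) A _ infinite (c , n₀ , r≡c) =
  Contradiction.absurd b e 0<b b₀<b 0<e {p} {t} pr p^t∣b₀ p^t∤b A infinite r≡c
  where
  b₀<b : ∀ i → b zero < b (suc i)
  b₀<b i = increasing zero (suc i) z<s
  0<b : ∀ i → 0 < b i
  0<b zero    = 0<b₀
  0<b (suc i) = ℕ.<-trans 0<b₀ (b₀<b i)
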